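{- Let $T$ be a finite tree, $\vec T$ any orientation of $T$, and $\mathbf{T}$ the poset on $V(T)$ with $u\le v$ iff $\vec T$ contains a directed path from $v$ to $u$ (so that $\vec T$ is its Hasse diagram). Then $\mathbf{J}(\mathbf{T})$ is an irreducible matchable distributive lattice.
   Context: For a finite poset $\mathbf{P}$, $\mathbf{J}(\mathbf{P})$ is the set of order ideals (down-sets) of $\mathbf{P}$ ordered by inclusion. A finite distributive lattice is irreducible if it is not isomorphic to a direct product of two or more lattices each with more than one element. For a plane bipartite graph $G$ with a fixed proper white/black coloring: a 1-factor is a perfect matching, $\mathcal{M}(G)$ the set of them; for $M\in\mathcal{M}(G)$ a cycle is $M$-alternating if its edges alternate in/out of $M$, and proper if each of its edges in $M$ goes from white to black end-vertex along the clockwise orientation of the cycle. $\vec Z(G)$ has vertex set $\mathcal{M}(G)$ and an arc $M_1\to M_2$ when $M_1\oplus M_2$ bounds an inner face and is a proper $M_1$-alternating cycle; $\mathbf{M}(G)$ is the poset on $\mathcal{M}(G)$ with $M_1\preceq M_2$ iff there is a directed path from $M_2$ to $M_1$. A finite distributive lattice $\mathbf{L}$ is a matchable distributive lattice (MDL) if $\mathbf{L}\cong\mathbf{M}(G)$ for some plane bipartite graph $G$. -}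

module Defs where

open import Level using (0ℓ)
open import Data.Nat using (ℕ; suc; _+_)
open import Data.Bool using (Bool; true; false; not; _xor_)
open import Data.Fin using (Fin)
open import Data.Fin.Subset using (Subset; _∈_; _⊆_)
open import Data.Vec using (lookup)
open import Data.Product using (Σ; ∃; ∃-syntax; _×_; _,_; proj₁; proj₂)
open import Data.Sum using (_⊎_; inj₁; inj₂)
open import Data.Unit using (⊤)
open import Relation.Nullary using (¬_)
open import Relation.Binary.PropositionalEquality using (_≡_; _≢_)
open import Relation.Binary.Construct.Closure.ReflexiveTransitive using (Star)
open import Relation.Binary.Lattice.Bundles using (Lattice)
open import Function.Bundles using (_⇔_)

iter : {A : Set} → (A → A) → ℕ → A → A
iter f 0 x = x
iter f (suc k) x = f (iter f k x)

record OrderIso {X Y : Set} (inX : X → Set) (_≤X_ : X → X → Set)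
                (inY : Y → Set) (_≈Y_ : Y → Y → Set) (_≤Y_ : Y → Y → Set) : Set where
  field
    to      : X → Y
    from    : Y → X
    to-in   : ∀ x → inX x → inY (to x)
    from-in : ∀ y → inY y → inX (from y)
    from-to : ∀ x → inX x → from (to x) ≡ x
    to-from : ∀ y → inY y → to (from y) ≈Y y
    order   : ∀ x x' → inX x → inX x' → (x ≤X x') ⇔ (to x ≤Y to x')

-- An orientation of a finite tree on vertex set Fin n: the tree has
-- k edges, edge i oriented as arc i = (tail , head).  A tree is a
-- connected graph with (number of vertices) = (number of edges) + 1.
record OrientedTree (n : ℕ) : Set where
  field
    k         : ℕ
    arc       : Fin k → Fin n × Fin n
    size      : suc k ≡ n
    connected : ∀ u v → Star (λ a b → ∃[ i ] (arc i ≡ (a , b) ⊎ arc i ≡ (b , a))) u v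

module _ {n : ℕ} (T : OrientedTree n) where
  open OrientedTree T

  TArc : Fin n → Fin n → Set
  TArc a b = ∃[ i ] arc i ≡ (a , b)

  _≤T_ : Fin n → Fin n → Set
  u ≤T v = Star TArc v u

  IsDownSet : Subset n → Set
  IsDownSet S = ∀ u v → u ≤T v → v ∈ S → u ∈ S

-- Irreducibility of a finite distributive lattice presented as a
-- subposet (carrier predicate inX, order ≤X, equality ≡)

Nontrivial : Lattice 0ℓ 0ℓ 0ℓ → Set
Nontrivial A = ∃[ x ] ∃[ y ] ¬ (Lattice._≈_ A x y)

IsoToProduct : {X : Set} (inX : X → Set) (_≤X_ : X → X → Set)
               (A B : Lattice 0ℓ 0ℓ 0ℓ) → Set
IsoToProduct inX _≤X_ A B =
  OrderIso inX _≤X_ (λ _ → ⊤)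
    (λ p q → Lattice._≈_ A (proj₁ p) (proj₁ q) × Lattice._≈_ B (proj₂ p) (proj₂ q))
    (λ p q → Lattice._≤_ A (proj₁ p) (proj₁ q) × Lattice._≤_ B (proj₂ p) (proj₂ q))

Irreducible : {X : Set} (inX : X → Set) (_≤X_ : X → X → Set) → Set₁
Irreducible inX _≤X_ =
  ∀ (A B : Lattice 0ℓ 0ℓ 0ℓ) → Nontrivial A → Nontrivial B →
  ¬ IsoToProduct inX _≤X_ A B

-- Plane bipartite graphs, encoded combinatorially by a rotation system
-- (a combinatorial map of genus 0) together with a choice of outer face.

-- darts: (e , true) is edge e seen from its white end,
--        (e , false) is edge e seen from its black end
Dart : ℕ → Set
Dart m = Fin m × Bool

α : {m : ℕ} → Dart m → Dart m
α (e , b) = (e , not b)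

dartTail : {nw nb m : ℕ} → (Fin m → Fin nw) → (Fin m → Fin nb) → Dart m → Fin nw ⊎ Fin nb
dartTail white black (e , true)  = inj₁ (white e)
dartTail white black (e , false) = inj₂ (black e)

record PlaneBipartiteGraph : Set where
  field
    nw nb m : ℕ
    white   : Fin m → Fin nw
    black   : Fin m → Fin nb
    simple  : ∀ e e' → white e ≡ white e' → black e ≡ black e' → e ≡ e'

  Vertex : Set
  Vertex = Fin nw ⊎ Fin nb

  tail : Dart m → Vertex
  tail = dartTail white black

  field
    connected : ∀ u v → Star (λ a b → ∃[ d ] (tail d ≡ a × tail (α d) ≡ b)) u v
    -- rotation system: σ d is the next dart counterclockwise around tail d
    σ       : Dart m → Dart m
    σ⁻¹     : Dart m → Dart m
    σσ⁻¹    : ∀ d → σ (σ⁻¹ d) ≡ d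
    σ⁻¹σ    : ∀ d → σ⁻¹ (σ d) ≡ d
    σ-tail  : ∀ d → tail (σ d) ≡ tail d
    σ-cyclic : ∀ d d' → tail d ≡ tail d' → ∃[ j ] iter σ j d ≡ d'

  -- face traversal permutation (faces on the left, i.e. inner faces
  -- are traversed counterclockwise)
  φ : Dart m → Dart m
  φ d = σ (α d)

  field
    F          : ℕ
    face       : Dart m → Fin F
    face-surj  : ∀ f → ∃[ d ] face d ≡ f
    face-orbit : ∀ d d' → (face d ≡ face d') ⇔ (∃[ j ] iter φ j d ≡ d')
    -- Euler's formula: the map has genus 0 (planarity)
    euler      : nw + nb + F ≡ m + 2
    outer      : Fin F

  edge : Dart m → Fin m
  edge = proj₁

  Incident : Fin m → Vertex → Set
  Incident e v = tail (e , true) ≡ v ⊎ tail (e , false) ≡ v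

  IsPerfectMatching : Subset m → Set
  IsPerfectMatching M =
    ∀ v → (∃[ e ] (e ∈ M × Incident e v)) ×
          (∀ e e' → e ∈ M → Incident e v → e' ∈ M → Incident e' v → e ≡ e')

  BoundaryIsCycle : Fin F → Set
  BoundaryIsCycle f =
    (∀ d d' → face d ≡ f → face d' ≡ f → tail d ≡ tail d' → d ≡ d') ×
    (∀ d d' → face d ≡ f → face d' ≡ f → edge d ≡ edge d' → d ≡ d')

  SymDiffBounds : Subset m → Subset m → Fin F → Set
  SymDiffBounds M₁ M₂ f =
    ∀ e → (lookup M₁ e xor lookup M₂ e ≡ true) ⇔ (∃[ d ] (face d ≡ f × edge d ≡ e))

  Alternating : Subset m → Fin F → Set
  Alternating M f = ∀ d → face d ≡ f → lookup M (edge d) xor lookup M (edge (φ d)) ≡ true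

  -- proper: every M-edge goes from white to black along the clockwise
  -- orientation of the (inner face) cycle; the face walk is counterclockwise,
  -- so its dart on such an edge must start at the black end.
  Proper : Subset m → Fin F → Set
  Proper M f = ∀ d → face d ≡ f → edge d ∈ M → proj₂ d ≡ false

  ZArc : Subset m → Subset m → Set
  ZArc M₁ M₂ = ∃[ f ] (f ≢ outer × BoundaryIsCycle f × SymDiffBounds M₁ M₂ f ×
                       Alternating M₁ f × Proper M₁ f)

  _⪯_ : Subset m → Subset m → Set
  M₁ ⪯ M₂ = Star ZArc M₂ M₁

IsMDL : {X : Set} (inX : X → Set) (_≤X_ : X → X → Set) → Set
IsMDL inX _≤X_ = ∃[ G ] OrderIso inX _≤X_
  (PlaneBipartiteGraph.IsPerfectMatching G) _≡_ (PlaneBipartiteGraph._⪯_ G)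

{-# OPTIONS --safe #-}

-- Irreducibility: a factorisation of J(T) yields two complementary down-sets, and since T is
-- connected one of them contains every vertex.
--
-- Matchability: T arises from a single vertex by attaching leaves, and an outerplane bipartite
-- graph whose inner faces are the vertices of T is built along.  A leaf of f is attached on an
-- edge shared by f and the outer face, of the one of the two colours (black to white or white
-- to black along f) that matches the orientation of the tree edge; the edge is subdivided
-- first, so that f keeps outer edges of both colours for further leaves.  A down-set S
-- corresponds to the matching of those edges whose face on the left of the black-to-white
-- dart lies in S while the face on the other side does not.  The outer edge of x of the first
-- kind is matched iff x ∈ S, which recovers S, and removing a maximal element of S from S
-- rotates the boundary cycle of its face.
module Submission where

open import Defs hiding (α)
open import Data.Bool using (Bool; true; false; not; _∧_; _∨_; _xor_; if_then_else_)
open import Data.Bool.Properties using (not-involutive; ∧-comm; ∧-identityʳ; ∧-zeroʳ; ∨-zeroʳ; xor-same; T-≡; ⇔→≡) renaming (_≟_ to _≟ᵇ_)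
open import Data.Empty using (⊥; ⊥-elim)
open import Data.Fin using (Fin; zero; suc)
open import Data.Fin.Patterns using (0F; 1F; 2F; 3F; 4F)
open import Data.Fin.Properties using (any?; injective⇒≤; ¬∀⟶∃¬) renaming (_≟_ to _≟ᶠ_)
open import Data.Fin.Subset using (Subset; _∈_; _⊆_; _∪_; _∩_) renaming (⊤ to full; ⊥ to empty)
open import Data.Fin.Subset.Properties using (x∈p∩q⁺; x∈p∩q⁻; x∈p∪q⁺; x∈p∪q⁻; p∩q⊆p; p∩q⊆q; p⊆p∪q; q⊆p∪q; ∉⊥; ∈⊤; ⊆⊤; ⊥⊆)
open import Data.Maybe using (Maybe; just; nothing) renaming (map to mapMaybe)
open import Data.Maybe.Properties using (just-injective)
open import Data.Nat using (ℕ; zero; suc; _+_; _≤_; _<_; _<ᵇ_; z≤n; s≤s)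
open import Data.Nat.Properties using (≤-refl; ≤-reflexive; ≤-trans; <⇒≤; <-irrefl; <-trans; <ᵇ⇒<; <⇒<ᵇ; n<1+n; m<n⇒m<1+n; m<1+n⇒m<n∨m≡n; 1+n≰n; suc-injective; +-suc) renaming (_≟_ to _≟ⁿ_)
open import Data.Product using (∃-syntax; _×_; _,_; proj₁; proj₂)
open import Data.Product.Properties using (,-injectiveˡ; ,-injectiveʳ; ≡-dec)
open import Data.Sum using (_⊎_; inj₁; inj₂; [_,_]′)
open import Data.Unit using (tt)
open import Data.Vec using (lookup; tabulate)
open import Data.Vec.Functional using (_∷_)
open import Data.Vec.Properties using (lookup∘tabulate; tabulate∘lookup; tabulate-cong; []=⇒lookup; lookup⇒[]=)
open import Function.Base using (_∘_)
open import Function.Bundles using (mk⇔; Equivalence)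
open import Function.Definitions using (Injective)
open import Relation.Binary.Construct.Closure.ReflexiveTransitive using (Star; ε; _◅_; _◅◅_; gmap; kleisliStar; reverse)
open import Relation.Binary.Lattice.Bundles using (Lattice)
open import Relation.Binary.PropositionalEquality using (_≡_; _≢_; refl; sym; trans; cong; cong₂; subst; subst₂)
open import Relation.Nullary using (¬_; Dec; yes; no; contradiction; _×-dec_)
open import Relation.Nullary.Decidable using (map′)
open import Relation.Unary using (Decidable)

-- Why the set assigned to a down-set `S` meets every vertex in exactly one edge: the outer boundary
-- passes through each vertex once, so the faces around a vertex form a row that starts and ends at
-- the outer face. Consecutive inner faces of the row are joined by tree edges that all point the
-- same way along it, so membership in `S` changes at most once. Counting the outer face as inside
-- at one end and as outside at the other makes it change exactly once, and the matched edge is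
-- where it changes. The proof obtains this by induction over ears. The conditions at the four new
-- vertices express all new edges through `s` and `x`, subject to one implication between these two,
-- and that implication is the closure condition for the new tree edge. To make an ear a matter of
-- finite case analysis, darts and vertices stay inductive types that gain constructors; they are
-- numbered by `Fin` only when the graph is assembled. Two subdividing vertices keep the colouring
-- proper, and the path of three edges makes the new face a four-cycle that has outer edges of both
-- colours.

-- Irreducibility

module _ {n : ℕ} (T : OrientedTree n) where
  open OrientedTree T

  IsArcClosed : Subset n → Set
  IsArcClosed S = ∀ a b → TArc T a b → a ∈ S → b ∈ S

  downSet⇒arcClosed : ∀ {S} → IsDownSet T S → IsArcClosed S
  downSet⇒arcClosed S↓ a b ab = S↓ b a (ab ◅ ε)

  arcClosed⇒downSet : ∀ {S} → IsArcClosed S → IsDownSet T S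
  arcClosed⇒downSet S↓ u .u ε u∈S = u∈S
  arcClosed⇒downSet S↓ u v (vw ◅ p) v∈S = arcClosed⇒downSet S↓ u _ p (S↓ v _ vw v∈S)

  -- Along an arc, `S` spreads by its own closure. Against an arc, a vertex outside `S` would lie in
  -- `S′`, whose closure would pull the starting vertex into `S′` as well, against disjointness.
  complemented-spreads : ∀ {S S′} → IsDownSet T S → IsDownSet T S′ →
    (∀ x → x ∈ S → x ∈ S′ → ⊥) → (∀ x → x ∈ S ⊎ x ∈ S′) →
    ∀ {u} → u ∈ S → ∀ v → v ∈ S
  complemented-spreads {S} {S′} S↓ S′↓ disjoint cover {u} u∈S v = go (connected u v) u∈S
    where
    step : ∀ {a b} → ∃[ i ] (arc i ≡ (a , b) ⊎ arc i ≡ (b , a)) → a ∈ S → b ∈ S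
    step (i , inj₁ ab) a∈S = downSet⇒arcClosed S↓ _ _ (i , ab) a∈S
    step {a} {b} (i , inj₂ ba) a∈S with cover b
    ... | inj₁ b∈S = b∈S
    ... | inj₂ b∈S′ = ⊥-elim (disjoint a a∈S (downSet⇒arcClosed S′↓ _ _ (i , ba) b∈S′))
    go : ∀ {a b} → Star _ a b → a ∈ S → b ∈ S
    go ε a∈S = a∈S
    go (s ◅ p) a∈S = go p (step s a∈S)

  root : Fin n
  root = subst Fin size zero

  irreducible : Irreducible (IsDownSet T) _⊆_
  irreducible A B (x₁ , x₂ , x₁≉x₂) (y₁ , y₂ , y₁≉y₂) iso =
    [ (λ r∈D → y₁≉y₂ (allB (λ v → complemented-spreads D↓ D′↓ disjoint cover r∈D v) y₁ y₂))
    , (λ r∈D′ → x₁≉x₂ (allA (λ v → complemented-spreads D′↓ D↓ (λ x p q → disjoint x q p)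
                            ([ inj₂ , inj₁ ]′ ∘ cover) r∈D′ v) x₁ x₂))
    ]′ (cover root)
    where
    open OrderIso iso
    module A = Lattice A
    module B = Lattice B

    empty↓ : IsDownSet T empty
    empty↓ _ _ _ = ⊥-elim ∘ ∉⊥

    full↓ : IsDownSet T full
    full↓ _ _ _ _ = ∈⊤

    mono : ∀ {S S′} → IsDownSet T S → IsDownSet T S′ → S ⊆ S′ →
           (proj₁ (to S) A.≤ proj₁ (to S′)) × (proj₂ (to S) B.≤ proj₂ (to S′))
    mono S↓ S′↓ = Equivalence.to (order _ _ S↓ S′↓)

    -- a₁, b₁ and a₀, b₀ are the tops and bottoms of the factors; (a₁ , b₀) and
    -- (a₀ , b₁) pull back to complementary down-sets D and D′.
    a₀ = proj₁ (to empty) ; b₀ = proj₂ (to empty)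
    a₁ = proj₁ (to full)  ; b₁ = proj₂ (to full)

    from↓ : ∀ p → IsDownSet T (from p)
    from↓ p = from-in p tt

    bot≤ : ∀ p → (a₀ A.≤ proj₁ p) × (b₀ B.≤ proj₂ p)
    bot≤ p = A.≤-respʳ-≈ (proj₁ (to-from p tt)) (proj₁ e) , B.≤-respʳ-≈ (proj₂ (to-from p tt)) (proj₂ e)
      where e = mono empty↓ (from↓ p) ⊥⊆

    ≤top : ∀ p → (proj₁ p A.≤ a₁) × (proj₂ p B.≤ b₁)
    ≤top p = A.≤-respˡ-≈ (proj₁ (to-from p tt)) (proj₁ e) , B.≤-respˡ-≈ (proj₂ (to-from p tt)) (proj₂ e)
      where e = mono (from↓ p) full↓ ⊆⊤

    D  = from (a₁ , b₀)
    D′ = from (a₀ , b₁)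

    D↓ : IsDownSet T D
    D↓ = from↓ _

    D′↓ : IsDownSet T D′
    D′↓ = from↓ _

    ∩↓ : IsDownSet T (D ∩ D′)
    ∩↓ u v u≤v v∈ = let (p , q) = x∈p∩q⁻ D D′ v∈ in x∈p∩q⁺ (D↓ u v u≤v p , D′↓ u v u≤v q)

    ∪↓ : IsDownSet T (D ∪ D′)
    ∪↓ u v u≤v v∈ = x∈p∪q⁺ ([ inj₁ ∘ D↓ u v u≤v , inj₂ ∘ D′↓ u v u≤v ]′ (x∈p∪q⁻ D D′ v∈))

    -- The image of `D ∩ D′` lies below `b₀` in the second factor because of `D` and below `a₀` in
    -- the first because of `D′`, hence below the image of `empty`; the isomorphism reflects this.
    disjoint : ∀ x → x ∈ D → x ∈ D′ → ⊥
    disjoint x x∈D x∈D′ = ∉⊥ (Equivalence.from (order _ _ ∩↓ empty↓)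
      ( A.≤-respʳ-≈ (proj₁ (to-from (a₀ , b₁) tt)) (proj₁ (mono ∩↓ D′↓ (p∩q⊆q D D′)))
      , B.≤-respʳ-≈ (proj₂ (to-from (a₁ , b₀) tt)) (proj₂ (mono ∩↓ D↓ (p∩q⊆p D D′))))
      (x∈p∩q⁺ (x∈D , x∈D′)))

    -- Dual to `disjoint`: the image of `D ∪ D′` lies above both tops.
    cover : ∀ x → x ∈ D ⊎ x ∈ D′
    cover x = x∈p∪q⁻ D D′ (Equivalence.from (order _ _ full↓ ∪↓)
      ( A.≤-respˡ-≈ (proj₁ (to-from (a₁ , b₀) tt)) (proj₁ (mono D↓ ∪↓ (p⊆p∪q D′)))
      , B.≤-respˡ-≈ (proj₂ (to-from (a₀ , b₁) tt)) (proj₂ (mono D′↓ ∪↓ (q⊆p∪q D D′))))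
      (∈⊤ {x = x}))

    -- A full `D` puts the top `b₁` below the bottom `b₀`, and the second factor collapses.
    allB : (∀ v → v ∈ D) → ∀ y y′ → y B.≈ y′
    allB D-full y y′ = B.antisym (le y y′) (le y′ y)
      where
      b₁≤b₀ : b₁ B.≤ b₀
      b₁≤b₀ = B.≤-respʳ-≈ (proj₂ (to-from (a₁ , b₀) tt)) (proj₂ (mono full↓ D↓ (λ {x} _ → D-full x)))
      le : ∀ y y′ → y B.≤ y′
      le y y′ = B.trans (proj₂ (≤top (a₀ , y))) (B.trans b₁≤b₀ (proj₂ (bot≤ (a₀ , y′))))

    allA : (∀ v → v ∈ D′) → ∀ x x′ → x A.≈ x′
    allA D′-full x x′ = A.antisym (le x x′) (le x′ x)
      where
      a₁≤a₀ : a₁ A.≤ a₀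
      a₁≤a₀ = A.≤-respʳ-≈ (proj₁ (to-from (a₀ , b₁) tt)) (proj₁ (mono full↓ D′↓ (λ {x} _ → D′-full x)))
      le : ∀ x x′ → x A.≤ x′
      le x x′ = A.trans (proj₁ (≤top (x , b₀))) (A.trans a₁≤a₀ (proj₁ (bot≤ (x′ , b₀))))

-- Oriented trees built by attaching leaves

-- The new leaf of ext C f b is zero; its edge to f points towards the leaf iff b is true.
data Code : ℕ → Set where
  single : Code 1
  ext    : ∀ {n} → Code n → Fin n → Bool → Code (suc n)

data CodeArc : ∀ {n} → Code n → Fin n → Fin n → Set where
  leaf→parent : ∀ {n} {C : Code n} {f} → CodeArc (ext C f false) zero (suc f)
  parent→leaf : ∀ {n} {C : Code n} {f} → CodeArc (ext C f true) (suc f) zero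
  keep        : ∀ {n} {C : Code n} {f b u v} → CodeArc C u v → CodeArc (ext C f b) (suc u) (suc v)

Closed : ∀ {n} → Code n → (Fin n → Bool) → Set
Closed C S = ∀ {u v} → CodeArc C u v → S u ≡ true → S v ≡ true

-- A linear extension of the tree order. A new leaf is maximal or minimal, so it can be placed at
-- the very top or at the very bottom of the ranking built so far.
rank : ∀ {n} → Code n → Fin n → ℕ
rank single _ = 0
rank (ext {n} C f false) zero = n
rank (ext C f false) (suc x) = rank C x
rank (ext C f true) zero = 0
rank (ext C f true) (suc x) = suc (rank C x)

rank< : ∀ {n} (C : Code n) x → rank C x < n
rank< single x = ≤-refl
rank< (ext C f false) zero = ≤-refl
rank< (ext C f false) (suc x) = m<n⇒m<1+n (rank< C x)
rank< (ext C f true) zero = s≤s z≤n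
rank< (ext C f true) (suc x) = s≤s (rank< C x)

rank-injective : ∀ {n} (C : Code n) x y → rank C x ≡ rank C y → x ≡ y
rank-injective single zero zero _ = refl
rank-injective (ext C f false) zero zero _ = refl
rank-injective (ext C f false) zero (suc y) e = contradiction (rank< C y) (<-irrefl (sym e))
rank-injective (ext C f false) (suc x) zero e = contradiction (rank< C x) (<-irrefl e)
rank-injective (ext C f false) (suc x) (suc y) e = cong suc (rank-injective C x y e)
rank-injective (ext C f true) zero zero _ = refl
rank-injective (ext C f true) (suc x) (suc y) e = cong suc (rank-injective C x y (suc-injective e))

rank-decreases : ∀ {n} {C : Code n} {u v} → CodeArc C u v → rank C v < rank C u
rank-decreases (leaf→parent {C = C} {f}) = rank< C f
rank-decreases parent→leaf = s≤s z≤n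
rank-decreases (keep {b = false} uv) = rank-decreases uv
rank-decreases (keep {b = true} uv) = s≤s (rank-decreases uv)

-- Every oriented tree arises by attaching leaves

record Presentation {n : ℕ} (T : OrientedTree n) : Set where
  field
    {order}       : ℕ
    code          : Code order
    label         : Fin order → Fin n
    unlabel       : Fin n → Fin order
    label-unlabel : ∀ v → label (unlabel v) ≡ v
    unlabel-label : ∀ x → unlabel (label x) ≡ x
    label-arc     : ∀ {x y} → CodeArc code x y → TArc T (label x) (label y)
    unlabel-arc   : ∀ {u v} → TArc T u v → CodeArc code (unlabel u) (unlabel v)

∷-injective : ∀ {n} {A : Set} {y} {f : Fin n → A} → Injective _≡_ _≡_ f → (∀ x → f x ≢ y) → Injective _≡_ _≡_ (y ∷ f)
∷-injective f-inj f≢y {zero} {zero} _ = refl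
∷-injective f-inj f≢y {zero} {suc b} e = contradiction (sym e) (f≢y b)
∷-injective f-inj f≢y {suc a} {zero} e = contradiction e (f≢y a)
∷-injective f-inj f≢y {suc a} {suc b} e = cong suc (f-inj e)

InImage : ∀ {m n} → (Fin m → Fin n) → Fin n → Set
InImage f y = ∃[ x ] f x ≡ y

inImage? : ∀ {m n} (f : Fin m → Fin n) → Decidable (InImage f)
inImage? f y = any? (λ x → f x ≟ᶠ y)

injective⇒surjective : ∀ {m n} {f : Fin m → Fin n} → Injective _≡_ _≡_ f → n ≤ m → ∀ y → InImage f y
injective⇒surjective {f = f} f-inj n≤m y with inImage? f y
... | yes y∈f = y∈f
... | no y∉f = contradiction
  (≤-trans (injective⇒≤ (∷-injective f-inj (λ x e → y∉f (x , e)))) n≤m) 1+n≰n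

missed : ∀ {m n} (f : Fin m → Fin n) → m < n → ∃[ y ] ¬ InImage f y
missed f m<n = ¬∀⟶∃¬ _ (InImage f) (inImage? f) λ all∈ →
  contradiction (≤-trans m<n (injective⇒≤ {f = proj₁ ∘ all∈}
    (λ {y} {y′} e → trans (sym (proj₂ (all∈ y))) (trans (cong f e) (proj₂ (all∈ y′)))))) 1+n≰n

crossing : ∀ {A : Set} {R : A → A → Set} {P : A → Set} → Decidable P →
  ∀ {x y} → Star R x y → P x → ¬ P y → ∃[ a ] ∃[ b ] (R a b × P a × ¬ P b)
crossing P? ε px ¬py = contradiction px ¬py
crossing P? (_◅_ {j = z} xz zy) px ¬py with P? z
... | yes pz = crossing P? zy pz ¬py
... | no ¬pz = _ , _ , xz , px , ¬pz

module _ {n : ℕ} (T : OrientedTree n) where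
  open OrientedTree T

  -- Acyclicity of the tree is present as its edge count, and `used` exploits it: the list holds `j`
  -- distinct arcs, all of them between labelled vertices and recorded in `code`. At `j = k` the
  -- list exhausts the arcs, so `code` misses none.
  record Grown (j : ℕ) : Set where
    field
      code      : Code (suc j)
      label     : Fin (suc j) → Fin n
      label-inj : Injective _≡_ _≡_ label
      used      : Fin j → Fin k
      used-inj  : Injective _≡_ _≡_ used
      used-arc  : ∀ i → ∃[ x ] ∃[ y ] (CodeArc code x y × arc (used i) ≡ (label x , label y))
      label-arc : ∀ {x y} → CodeArc code x y → TArc T (label x) (label y)

  grow-step : ∀ {j} → suc j < n → Grown j → Grown (suc j)
  -- A path from a labelled to an unlabelled vertex has an edge that leaves the labelled set; its
  -- far end is the next leaf.
  grow-step {j} j<n G = attach (crossing (inImage? label) (connected (label zero) out) (zero , refl) out∉)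
    where
    open Grown G
    out  = proj₁ (missed label j<n)
    out∉ = proj₂ (missed label j<n)

    -- Both ends of a used arc are labelled, whereas `y` is not.
    unused : ∀ {i y} → ¬ InImage label y → (∃[ x ] (arc i ≡ (x , y) ⊎ arc i ≡ (y , x))) → ∀ l → used l ≢ i
    unused y∉ (_ , inj₁ e) l refl with used-arc l
    ... | _ , b , _ , e′ = y∉ (b , ,-injectiveʳ (trans (sym e′) e))
    unused y∉ (_ , inj₂ e) l refl with used-arc l
    ... | a , _ , _ , e′ = y∉ (a , ,-injectiveˡ (trans (sym e′) e))

    attach : ∃[ a ] ∃[ y ] ((∃[ i ] (arc i ≡ (a , y) ⊎ arc i ≡ (y , a))) × InImage label a × ¬ InImage label y) →
             Grown (suc j)
    attach (a , y , (i , e) , (f , refl) , y∉) = record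
      { code      = ext code f (towards e)
      ; label     = y ∷ label
      ; label-inj = ∷-injective label-inj (λ x e′ → y∉ (x , e′))
      ; used      = i ∷ used
      ; used-inj  = ∷-injective used-inj (unused y∉ (a , e))
      ; used-arc  = λ { zero → first e ; (suc l) → let (x , x′ , xx′ , e′) = used-arc l in suc x , suc x′ , keep xx′ , e′ }
      ; label-arc = arcs e
      }
      where
      towards : arc i ≡ (label f , y) ⊎ arc i ≡ (y , label f) → Bool
      towards (inj₁ _) = true
      towards (inj₂ _) = false
      first : ∀ e → ∃[ x ] ∃[ x′ ] (CodeArc (ext code f (towards e)) x x′ × arc i ≡ ((y ∷ label) x , (y ∷ label) x′))
      first (inj₁ e) = suc f , zero , parent→leaf , e
      first (inj₂ e) = zero , suc f , leaf→parent , e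
      arcs : ∀ e {x x′} → CodeArc (ext code f (towards e)) x x′ → TArc T ((y ∷ label) x) ((y ∷ label) x′)
      arcs (inj₁ e) parent→leaf = i , e
      arcs (inj₁ e) (keep xx′) = label-arc xx′
      arcs (inj₂ e) leaf→parent = i , e
      arcs (inj₂ e) (keep xx′) = label-arc xx′

  grow : ∀ j → suc j ≤ n → Grown j
  grow zero _ = record
    { code      = single
    ; label     = λ _ → root T
    ; label-inj = λ { {zero} {zero} _ → refl }
    ; used      = λ ()
    ; used-inj  = λ { {()} }
    ; used-arc  = λ ()
    ; label-arc = λ ()
    }
  grow (suc j) j<n = grow-step j<n (grow j (<⇒≤ j<n))

  presentation : Presentation T
  presentation = record
    { code          = code
    ; label         = label
    ; unlabel       = unlabel
    ; label-unlabel = label-unlabel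
    ; unlabel-label = unlabel-label
    ; label-arc     = label-arc
    ; unlabel-arc   = unlabel-arc
    }
    where
    open Grown (grow k (≤-reflexive size))
    onto : ∀ v → InImage label v
    onto = injective⇒surjective label-inj (≤-reflexive (sym size))
    unlabel : Fin n → Fin (suc k)
    unlabel v = proj₁ (onto v)
    label-unlabel : ∀ v → label (unlabel v) ≡ v
    label-unlabel v = proj₂ (onto v)
    unlabel-label : ∀ x → unlabel (label x) ≡ x
    unlabel-label x = label-inj (label-unlabel (label x))
    unlabel-arc : ∀ {u v} → TArc T u v → CodeArc code (unlabel u) (unlabel v)
    -- `used` is now an injection of `Fin k` into itself, so the arc `i` was used at some stage.
    unlabel-arc (i , e) with injective⇒surjective used-inj ≤-refl i
    ... | l , refl with used-arc l
    ... | x , y , xy , e′ with trans (sym e) e′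
    ... | refl rewrite unlabel-label x | unlabel-label y = xy

-- Perfect matchings, as sets of darts

module _ {D V : Set} (tail : D → V) (M : D → Bool) where

  -- Invariance of `M` under reversal is imposed separately; with it, a matched edge is seen as a
  -- matched dart from each of its ends.
  ExactlyOne : V → Set
  ExactlyOne v = ∃[ d ] (tail d ≡ v × M d ≡ true × (∀ d′ → tail d′ ≡ v → M d′ ≡ true → d′ ≡ d))

  Perfect : Set
  Perfect = ∀ v → ExactlyOne v

module _ {D V : Set} {tail : D → V} {M : D → Bool} where

  exclusive : ∀ {v d d′} → ExactlyOne tail M v → tail d ≡ v → tail d′ ≡ v →
              M d ≡ true → M d′ ≡ true → d ≡ d′
  exclusive (_ , _ , _ , uniq) dv d′v dM d′M = trans (uniq _ dv dM) (sym (uniq _ d′v d′M))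

  module _ {v : V} {d₁ d₂ : D} (t₁ : tail d₁ ≡ v) (t₂ : tail d₂ ≡ v)
           (only : ∀ d → tail d ≡ v → d ≡ d₁ ⊎ d ≡ d₂) where

    two⇒ : d₁ ≢ d₂ → ExactlyOne tail M v → M d₂ ≡ not (M d₁)
    two⇒ d₁≢d₂ one with M d₁ in e₁ | M d₂ in e₂
    ... | true  | true  = contradiction (exclusive one t₁ t₂ e₁ e₂) d₁≢d₂
    ... | true  | false = refl
    ... | false | true  = refl
    ... | false | false with one
    ...   | d , dv , dM , _ with only d dv
    ...     | inj₁ refl = trans (sym e₂) (contradiction (trans (sym dM) e₁) λ ())
    ...     | inj₂ refl = trans (sym e₂) dM

    two⇐ : M d₂ ≡ not (M d₁) → ExactlyOne tail M v
    two⇐ e with M d₁ in e₁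
    ... | true = d₁ , t₁ , e₁ , λ d dv dM →
      [ (λ d≡ → d≡) , (λ { refl → contradiction (trans (sym dM) e) λ () }) ]′ (only d dv)
    ... | false = d₂ , t₂ , e , λ d dv dM →
      [ (λ { refl → contradiction (trans (sym dM) e₁) λ () }) , (λ d≡ → d≡) ]′ (only d dv)

  module _ {v : V} {d₁ d₂ d₃ : D} (t₁ : tail d₁ ≡ v) (t₂ : tail d₂ ≡ v) (t₃ : tail d₃ ≡ v)
           (only : ∀ d → tail d ≡ v → d ≡ d₁ ⊎ d ≡ d₂ ⊎ d ≡ d₃) where

    -- The condition is solved for `d₂`, with the exclusion of `d₁` and `d₃` as what remains. It
    -- serves the vertex `u₁`, where `d₂` belongs to the edge shared by the old and the new face.
    three⇒ : d₁ ≢ d₂ → d₂ ≢ d₃ → d₁ ≢ d₃ → ExactlyOne tail M v →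
             M d₂ ≡ not (M d₁) ∧ not (M d₃) × (M d₃ ≡ true → M d₁ ≡ false)
    three⇒ n₁₂ n₂₃ n₁₃ one with M d₁ in e₁ | M d₂ in e₂ | M d₃ in e₃
    ... | true  | true  | _     = contradiction (exclusive one t₁ t₂ e₁ e₂) n₁₂
    ... | true  | false | true  = contradiction (exclusive one t₁ t₃ e₁ e₃) n₁₃
    ... | true  | false | false = refl , λ ()
    ... | false | true  | true  = contradiction (exclusive one t₂ t₃ e₂ e₃) n₂₃
    ... | false | true  | false = refl , λ _ → refl
    ... | false | false | true  = refl , λ _ → refl
    ... | false | false | false with one
    ...   | d , dv , dM , _ with only d dv
    ...     | inj₁ refl        = contradiction (trans (sym dM) e₁) λ ()
    ...     | inj₂ (inj₁ refl) = contradiction (trans (sym dM) e₂) λ ()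
    ...     | inj₂ (inj₂ refl) = contradiction (trans (sym dM) e₃) λ ()

    three⇐ : M d₂ ≡ not (M d₁) ∧ not (M d₃) → (M d₃ ≡ true → M d₁ ≡ false) → ExactlyOne tail M v
    three⇐ e n with M d₁ in e₁ | M d₃ in e₃
    ... | true | true = contradiction (n refl) λ ()
    ... | true | false = d₁ , t₁ , e₁ , λ d dv dM → pick d dM (only d dv)
      where
      pick : ∀ d → M d ≡ true → d ≡ d₁ ⊎ d ≡ d₂ ⊎ d ≡ d₃ → d ≡ d₁
      pick d dM (inj₁ d≡) = d≡
      pick d dM (inj₂ (inj₁ refl)) = contradiction (trans (sym dM) e) λ ()
      pick d dM (inj₂ (inj₂ refl)) = contradiction (trans (sym dM) e₃) λ ()
    ... | false | true = d₃ , t₃ , e₃ , λ d dv dM → pick d dM (only d dv)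
      where
      pick : ∀ d → M d ≡ true → d ≡ d₁ ⊎ d ≡ d₂ ⊎ d ≡ d₃ → d ≡ d₃
      pick d dM (inj₁ refl) = contradiction (trans (sym dM) e₁) λ ()
      pick d dM (inj₂ (inj₁ refl)) = contradiction (trans (sym dM) e) λ ()
      pick d dM (inj₂ (inj₂ d≡)) = d≡
    ... | false | false = d₂ , t₂ , e , λ d dv dM → pick d dM (only d dv)
      where
      pick : ∀ d → M d ≡ true → d ≡ d₁ ⊎ d ≡ d₂ ⊎ d ≡ d₃ → d ≡ d₂
      pick d dM (inj₁ refl) = contradiction (trans (sym dM) e₁) λ ()
      pick d dM (inj₂ (inj₁ d≡)) = d≡
      pick d dM (inj₂ (inj₂ refl)) = contradiction (trans (sym dM) e₃) λ ()

  perfect-resp : ∀ {M′ : D → Bool} → (∀ d → M′ d ≡ M d) → Perfect tail M → Perfect tail M′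
  perfect-resp e P v with P v
  ... | d , dv , dM , uniq = d , dv , trans (e d) dM , λ d′ d′v d′M → uniq d′ d′v (trans (sym (e d′)) d′M)

-- Plane maps with one inner face per tree vertex

-- Orbits are chains of steps instead of iteration counts, because an ear replaces one step by
-- several and chains can be spliced. The counts are recovered by `orbit⇒iter`.
Step : {A : Set} → (A → A) → A → A → Set
Step f x y = f x ≡ y

-- The outer face counts as inside the down-set when seen from a black end and as outside
-- it when seen from a white end.
insideB insideW : ∀ {n} → (Fin n → Bool) → Fin (suc n) → Bool
insideB S zero    = true
insideB S (suc x) = S x
insideW S zero    = false
insideW S (suc x) = S x

edgeValue : ∀ {n} → (Fin n → Bool) → Bool → Fin (suc n) → Fin (suc n) → Bool
edgeValue S false g h = insideB S g ∧ not (insideW S h)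
edgeValue S true  g h = insideB S h ∧ not (insideW S g)

edgeValue-swap : ∀ {n} (S : Fin n → Bool) b g h → edgeValue S (not b) h g ≡ edgeValue S b g h
edgeValue-swap S true  g h = refl
edgeValue-swap S false g h = refl

edgeValue-outer : ∀ {n} (S : Fin n → Bool) b x → edgeValue S b (suc x) zero ≡ b xor S x
edgeValue-outer S true  x = refl
edgeValue-outer S false x = ∧-identityʳ (S x)

edgeValue-cong : ∀ {n} {S S′ : Fin n → Bool} b g h → (∀ x → g ≡ suc x ⊎ h ≡ suc x → S x ≡ S′ x) →
                 edgeValue S b g h ≡ edgeValue S′ b g h
edgeValue-cong {S = S} {S′} b g h e = go b
  where
  inB : ∀ g → (∀ x → g ≡ suc x → S x ≡ S′ x) → insideB S g ≡ insideB S′ g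
  inB zero    _ = refl
  inB (suc x) e = e x refl
  inW : ∀ g → (∀ x → g ≡ suc x → S x ≡ S′ x) → insideW S g ≡ insideW S′ g
  inW zero    _ = refl
  inW (suc x) e = e x refl
  go : ∀ b → edgeValue S b g h ≡ edgeValue S′ b g h
  go true  = cong₂ (λ a b → a ∧ not b) (inB h (λ x → e x ∘ inj₂)) (inW g (λ x → e x ∘ inj₁))
  go false = cong₂ (λ a b → a ∧ not b) (inB g (λ x → e x ∘ inj₁)) (inW h (λ x → e x ∘ inj₂))

-- Face zero is the outer face and face suc x belongs to the tree vertex x; face d lies on the
-- left of d.  find and at only serve to show that a dart is determined by its two ends, resp.
-- by its inner face and its tail.  side x b lies on x, has colour b, and its reverse is outer.
record PlaneMap {n : ℕ} (C : Code n) : Set₁ where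
  field
    D V         : Set
    m l         : ℕ
    encD        : D → Fin m × Bool
    decD        : Fin m × Bool → D
    encD-decD   : ∀ i → encD (decD i) ≡ i
    decD-encD   : ∀ d → decD (encD d) ≡ d
    encV        : V → Fin l × Bool
    decV        : Fin l × Bool → V
    encV-decV   : ∀ i → encV (decV i) ≡ i
    decV-encV   : ∀ v → decV (encV v) ≡ v
    rev         : D → D
    encD-rev    : ∀ d → encD (rev d) ≡ (proj₁ (encD d) , not (proj₂ (encD d)))
    tail        : D → V
    euler       : l + l + suc n ≡ m + 2

  colour : D → Bool
  colour d = proj₂ (encD d)

  field
    tail-colour : ∀ d → proj₂ (encV (tail d)) ≡ colour d
    φ ψ         : D → D
    φψ          : ∀ d → φ (ψ d) ≡ d
    ψφ          : ∀ d → ψ (φ d) ≡ d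
    tail-φ      : ∀ d → tail (φ d) ≡ tail (rev d)
    find        : V → V → Maybe D
    find-ends   : ∀ d → find (tail d) (tail (rev d)) ≡ just d
    origin      : V
    reach       : ∀ v → Star (λ a b → ∃[ d ] (tail d ≡ a × tail (rev d) ≡ b)) origin v

  σ : D → D
  σ = φ ∘ rev

  field
    dartAt      : V → D
    toDartAt    : ∀ d → Star (Step σ) d (dartAt (tail d))
    fromDartAt  : ∀ d → Star (Step σ) (dartAt (tail d)) d
    face        : D → Fin (suc n)
    face-φ      : ∀ d → face (φ d) ≡ face d
    dartOn      : Fin (suc n) → D
    face-dartOn : ∀ f → face (dartOn f) ≡ f
    toDartOn    : ∀ d → Star (Step φ) d (dartOn (face d))
    fromDartOn  : ∀ d → Star (Step φ) (dartOn (face d)) d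
    face-rev    : ∀ d → face (rev d) ≢ face d
    at          : Fin n → V → Maybe D
    at-tail     : ∀ {x} d → face d ≡ suc x → at x (tail d) ≡ just d
    side        : Fin n → Bool → D
    side-colour : ∀ x b → colour (side x b) ≡ b
    side-face   : ∀ x b → face (side x b) ≡ suc x
    side-outer  : ∀ x b → face (rev (side x b)) ≡ zero
    face-arc    : ∀ {u v} d → colour d ≡ false → face d ≡ suc u → face (rev d) ≡ suc v → CodeArc C v u

  matching : (Fin n → Bool) → D → Bool
  matching S d = edgeValue S (colour d) (face d) (face (rev d))

  Symmetric : (D → Bool) → Set
  Symmetric M = ∀ d → M (rev d) ≡ M d

  downSet : (D → Bool) → Fin n → Bool
  downSet M x = M (side x false)

  field
    matching-perfect : ∀ S → Closed C S → Perfect tail (matching S)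
    downSet-closed   : ∀ M → Symmetric M → Perfect tail M → Closed C (downSet M)
    matching-downSet : ∀ M → Symmetric M → Perfect tail M → ∀ d → M d ≡ matching (downSet M) d

  encD-injective : ∀ {d d′} → encD d ≡ encD d′ → d ≡ d′
  encD-injective {d} {d′} e = trans (sym (decD-encD d)) (trans (cong decD e) (decD-encD d′))

  _≟_ : (d d′ : D) → Dec (d ≡ d′)
  d ≟ d′ = map′ encD-injective (cong encD) (≡-dec _≟ᶠ_ _≟ᵇ_ (encD d) (encD d′))

  rev-rev : ∀ d → rev (rev d) ≡ d
  rev-rev d = encD-injective (trans (encD-rev (rev d))
    (trans (cong (λ i → proj₁ i , not (proj₂ i)) (encD-rev d)) (cong (proj₁ (encD d) ,_) (not-involutive _))))

  colour-rev : ∀ d → colour (rev d) ≡ not (colour d)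
  colour-rev d = cong proj₂ (encD-rev d)

  matching-symmetric : ∀ S → Symmetric (matching S)
  matching-symmetric S d rewrite rev-rev d | colour-rev d = edgeValue-swap S (colour d) (face d) (face (rev d))

  matching-side : ∀ S {x} d → face d ≡ suc x → face (rev d) ≡ zero → matching S d ≡ colour d xor S x
  matching-side S {x} d e e′ rewrite e | e′ = edgeValue-outer S (colour d) x

  -- The walk passes through the base dart of the face. Having chains both to and from base darts
  -- replaces the argument that some power of a finite permutation inverts it.
  sameFace⇒orbit : ∀ {d d′} → face d ≡ face d′ → Star (Step φ) d d′
  sameFace⇒orbit {d} {d′} e = toDartOn d ◅◅ subst (λ f → Star (Step φ) (dartOn f) d′) (sym e) (fromDartOn d′)

  sameTail⇒orbit : ∀ {d d′} → tail d ≡ tail d′ → Star (Step σ) d d′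
  sameTail⇒orbit {d} {d′} e = toDartAt d ◅◅ subst (λ v → Star (Step σ) (dartAt v) d′) (sym e) (fromDartAt d′)

same-or-not : ∀ b c → b ≡ c ⊎ b ≡ not c
same-or-not false false = inj₁ refl
same-or-not false true  = inj₂ refl
same-or-not true  false = inj₂ refl
same-or-not true  true  = inj₁ refl

-- The square

module Square where
  D V : Set
  D = Fin 4 × Bool
  V = Fin 2 × Bool

  rev : D → D
  rev (e , b) = e , not b

  tail : D → V
  tail (0F , b)     = 0F , b
  tail (1F , true)  = 1F , true
  tail (1F , false) = 0F , false
  tail (2F , b)     = 1F , b
  tail (3F , true)  = 0F , true
  tail (3F , false) = 1F , false

  -- inner face: w₀ b₀ w₁ b₁, counterclockwise
  φ ψ : D → D
  φ (0F , true)  = 1F , false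
  φ (1F , false) = 2F , true
  φ (2F , true)  = 3F , false
  φ (3F , false) = 0F , true
  φ (0F , false) = 3F , true
  φ (3F , true)  = 2F , false
  φ (2F , false) = 1F , true
  φ (1F , true)  = 0F , false
  ψ (1F , false) = 0F , true
  ψ (2F , true)  = 1F , false
  ψ (3F , false) = 2F , true
  ψ (0F , true)  = 3F , false
  ψ (3F , true)  = 0F , false
  ψ (2F , false) = 3F , true
  ψ (1F , true)  = 2F , false
  ψ (0F , false) = 1F , true

  face : D → Fin 2
  face (0F , true)  = 1F
  face (1F , false) = 1F
  face (2F , true)  = 1F
  face (3F , false) = 1F
  face (0F , false) = 0F
  face (1F , true)  = 0F
  face (2F , false) = 0F
  face (3F , true)  = 0F

  forDarts : ∀ {P : D → Set} →
    P (0F , true) → P (0F , false) → P (1F , true) → P (1F , false) →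
    P (2F , true) → P (2F , false) → P (3F , true) → P (3F , false) → ∀ d → P d
  forDarts a b c d e f g h (0F , true)  = a
  forDarts a b c d e f g h (0F , false) = b
  forDarts a b c d e f g h (1F , true)  = c
  forDarts a b c d e f g h (1F , false) = d
  forDarts a b c d e f g h (2F , true)  = e
  forDarts a b c d e f g h (2F , false) = f
  forDarts a b c d e f g h (3F , true)  = g
  forDarts a b c d e f g h (3F , false) = h

  find : V → V → Maybe D
  find (0F , true)  (0F , false) = just (0F , true)
  find (0F , false) (0F , true)  = just (0F , false)
  find (1F , true)  (0F , false) = just (1F , true)
  find (0F , false) (1F , true)  = just (1F , false)
  find (1F , true)  (1F , false) = just (2F , true)
  find (1F , false) (1F , true)  = just (2F , false)
  find (0F , true)  (1F , false) = just (3F , true)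
  find (1F , false) (0F , true)  = just (3F , false)
  find _ _ = nothing

  reach : ∀ v → Star (λ a b → ∃[ d ] (tail d ≡ a × tail (rev d) ≡ b)) (0F , true) v
  reach (0F , true)  = ε
  reach (0F , false) = ((0F , true) , refl , refl) ◅ ε
  reach (1F , true)  = ((0F , true) , refl , refl) ◅ ((1F , false) , refl , refl) ◅ ε
  reach (1F , false) = ((3F , true) , refl , refl) ◅ ε

  dartAt : V → D
  dartAt (0F , b) = 0F , b
  dartAt (1F , b) = 2F , b

  dartOn : Fin 2 → D
  dartOn 0F = 0F , false
  dartOn 1F = 0F , true

  at : Fin 1 → V → Maybe D
  at _ (0F , true)  = just (0F , true)
  at _ (0F , false) = just (1F , false)
  at _ (1F , true)  = just (2F , true)
  at _ (1F , false) = just (3F , false)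

  side : Fin 1 → Bool → D
  side _ true  = 0F , true
  side _ false = 1F , false

  pattern l₁ = inj₁ refl
  pattern l₂ = inj₂ refl

  only₁ : ∀ d → tail d ≡ (0F , true) → d ≡ (0F , true) ⊎ d ≡ (3F , true)
  only₁ = forDarts (λ _ → l₁) (λ ()) (λ ()) (λ ()) (λ ()) (λ ()) (λ _ → l₂) (λ ())
  only₂ : ∀ d → tail d ≡ (0F , false) → d ≡ (0F , false) ⊎ d ≡ (1F , false)
  only₂ = forDarts (λ ()) (λ _ → l₁) (λ ()) (λ _ → l₂) (λ ()) (λ ()) (λ ()) (λ ())
  only₃ : ∀ d → tail d ≡ (1F , true) → d ≡ (1F , true) ⊎ d ≡ (2F , true)
  only₃ = forDarts (λ ()) (λ ()) (λ _ → l₁) (λ ()) (λ _ → l₂) (λ ()) (λ ()) (λ ())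
  only₄ : ∀ d → tail d ≡ (1F , false) → d ≡ (2F , false) ⊎ d ≡ (3F , false)
  only₄ = forDarts (λ ()) (λ ()) (λ ()) (λ ()) (λ ()) (λ _ → l₁) (λ ()) (λ _ → l₂)

  value : Bool → D → Bool
  value s (0F , _) = not s
  value s (1F , _) = s
  value s (2F , _) = not s
  value s (3F , _) = s

  value-perfect : ∀ s → Perfect tail (value s)
  value-perfect s (0F , true)  = two⇐ refl refl only₁ (sym (not-involutive s))
  value-perfect s (0F , false) = two⇐ refl refl only₂ (sym (not-involutive s))
  value-perfect s (1F , true)  = two⇐ refl refl only₃ refl
  value-perfect s (1F , false) = two⇐ refl refl only₄ (sym (not-involutive s))

  -- Every vertex has degree two and so negates the value; starting from edge `1F`, this fixes the
  -- other three.
  perfect-value : ∀ M → (∀ d → M (rev d) ≡ M d) → Perfect tail M → ∀ d → M d ≡ value (M (1F , false)) d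
  perfect-value M symm P = forDarts
    (trans (sym (symm (0F , true))) m₀) m₀ m₁ refl m₂ (trans (symm (2F , true)) m₂)
    (trans (sym (symm (3F , true))) m₃) m₃
    where
    s  = M (1F , false)
    m₁ : M (1F , true) ≡ s
    m₁ = sym (symm (1F , true))
    m₀ : M (0F , false) ≡ not s
    m₀ = trans (sym (not-involutive _)) (cong not (sym (two⇒ refl refl only₂ (λ ()) (P _))))
    m₂ : M (2F , true) ≡ not s
    m₂ = trans (two⇒ refl refl only₃ (λ ()) (P _)) (cong not m₁)
    m₃ : M (3F , false) ≡ s
    m₃ = trans (two⇒ refl refl only₄ (λ ()) (P _))
           (trans (cong not (trans (symm (2F , true)) m₂)) (not-involutive s))

  square : PlaneMap single
  square = record
    { D = D ; V = V ; m = 4 ; l = 2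
    ; encD = λ d → d ; decD = λ d → d ; encD-decD = λ _ → refl ; decD-encD = λ _ → refl
    ; encV = λ v → v ; decV = λ v → v ; encV-decV = λ _ → refl ; decV-encV = λ _ → refl
    ; rev = rev ; encD-rev = λ _ → refl ; tail = tail ; euler = refl
    ; tail-colour = forDarts refl refl refl refl refl refl refl refl
    ; φ = φ ; ψ = ψ
    ; φψ = forDarts refl refl refl refl refl refl refl refl
    ; ψφ = forDarts refl refl refl refl refl refl refl refl
    ; tail-φ = forDarts refl refl refl refl refl refl refl refl
    ; find = find ; find-ends = forDarts refl refl refl refl refl refl refl refl
    ; origin = 0F , true ; reach = reach
    ; dartAt = dartAt
    ; toDartAt = forDarts ε ε (refl ◅ ε) (refl ◅ ε) ε ε (refl ◅ ε) (refl ◅ ε)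
    ; fromDartAt = forDarts ε ε (refl ◅ ε) (refl ◅ ε) ε ε (refl ◅ ε) (refl ◅ ε)
    ; face = face ; face-φ = forDarts refl refl refl refl refl refl refl refl
    ; dartOn = dartOn ; face-dartOn = λ { 0F → refl ; 1F → refl }
    ; toDartOn = forDarts ε ε (refl ◅ ε) (refl ◅ refl ◅ refl ◅ ε) (refl ◅ refl ◅ ε)
        (refl ◅ refl ◅ ε) (refl ◅ refl ◅ refl ◅ ε) (refl ◅ ε)
    ; fromDartOn = forDarts ε ε (refl ◅ refl ◅ refl ◅ ε) (refl ◅ ε) (refl ◅ refl ◅ ε)
        (refl ◅ refl ◅ ε) (refl ◅ ε) (refl ◅ refl ◅ refl ◅ ε)
    ; face-rev = forDarts (λ ()) (λ ()) (λ ()) (λ ()) (λ ()) (λ ()) (λ ()) (λ ())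
    ; at = at
    ; at-tail = forDarts (λ _ → refl) (λ ()) (λ ()) (λ _ → refl) (λ _ → refl) (λ ()) (λ ()) (λ _ → refl)
    ; side = side
    ; side-colour = λ { _ true → refl ; _ false → refl }
    ; side-face = λ { 0F true → refl ; 0F false → refl }
    ; side-outer = λ { 0F true → refl ; 0F false → refl }
    ; face-arc = forDarts (λ ()) (λ _ ()) (λ ()) (λ _ _ ()) (λ ()) (λ _ ()) (λ ()) (λ _ _ ())
    ; matching-perfect = λ S _ → perfect-resp (λ d → value≡ S d) (value-perfect (S 0F))
    ; downSet-closed = λ _ _ _ ()
    ; matching-downSet = λ M symm P d → trans (perfect-value M symm P d) (sym (value≡ (λ _ → M (1F , false)) d))
    }
    where
    value≡ : ∀ S d → _ ≡ value (S 0F) d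
    value≡ S = forDarts refl refl (∧-identityʳ _) (∧-identityʳ _) refl refl (∧-identityʳ _) (∧-identityʳ _)

-- Attaching a leaf: the outer edge s = uv of face f is replaced by the path u s v₁ p u₁ q v,
-- and the new face is bounded by q and the path u₁ x v₂ y u₂ t v.  The darts s⁺ p⁺ q⁺ and
-- x⁺ y⁺ t⁺ run from u towards v.

data Dart⁺ (D : Set) : Set where
  old : D → Dart⁺ D
  p⁺ p⁻ q⁺ q⁻ x⁺ x⁻ y⁺ y⁻ t⁺ t⁻ : Dart⁺ D

data Vertex⁺ (V : Set) : Set where
  old : V → Vertex⁺ V
  u₁ v₁ u₂ v₂ : Vertex⁺ V

old-injective : ∀ {D} {d d′ : D} → _≡_ {A = Dart⁺ D} (old d) (old d′) → d ≡ d′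
old-injective refl = refl

-- The leaf is tree vertex `zero`, so its face takes index one; inner faces shift past it and the
-- outer face keeps index zero.
liftFace : ∀ {n} → Fin (suc n) → Fin (suc (suc n))
liftFace zero    = zero
liftFace (suc x) = suc (suc x)

liftFace-injective : ∀ {n} (g h : Fin (suc n)) → liftFace g ≡ liftFace h → g ≡ h
liftFace-injective zero    zero    _    = refl
liftFace-injective (suc x) (suc x) refl = refl

edgeValue-lift : ∀ {n} (S : Fin (suc n) → Bool) b g h →
  edgeValue S b (liftFace g) (liftFace h) ≡ edgeValue (S ∘ suc) b g h
edgeValue-lift S true  zero    zero    = refl
edgeValue-lift S true  zero    (suc _) = refl
edgeValue-lift S true  (suc _) zero    = refl
edgeValue-lift S true  (suc _) (suc _) = refl
edgeValue-lift S false zero    zero    = refl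
edgeValue-lift S false zero    (suc _) = refl
edgeValue-lift S false (suc _) zero    = refl
edgeValue-lift S false (suc _) (suc _) = refl

not-xor : ∀ c → not c xor c ≡ true
not-xor true  = refl
not-xor false = refl

not-xorˡ : ∀ a b → not a xor b ≡ not (a xor b)
not-xorˡ true  b = sym (not-involutive b)
not-xorˡ false b = refl

module Ear {n : ℕ} {C : Code n} (G : PlaneMap C) (f : Fin n) (c : Bool) where
  open PlaneMap G

  s⁻ s⁺ : D
  s⁻ = side f c
  s⁺ = rev s⁻

  face-s⁻ : face s⁻ ≡ suc f
  face-s⁻ = side-face f c

  face-s⁺ : face s⁺ ≡ zero
  face-s⁺ = side-outer f c

  colour-s⁻ : colour s⁻ ≡ c
  colour-s⁻ = side-colour f c

  s⁺≢s⁻ : s⁺ ≢ s⁻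
  s⁺≢s⁻ e with trans (sym face-s⁺) (trans (cong face e) face-s⁻)
  ... | ()

  -- `φ` preserves faces, and these darts lie on different ones. This keeps the two special cases of
  -- `ψ⁺` apart.
  φs⁺≢s⁻ : φ s⁺ ≢ s⁻
  φs⁺≢s⁻ e with trans (sym face-s⁺) (trans (sym (face-φ s⁺)) (trans (cong face e) face-s⁻))
  ... | ()

  ψs⁻≢s⁺ : ψ s⁻ ≢ s⁺
  ψs⁻≢s⁺ e = φs⁺≢s⁻ (trans (cong φ (sym e)) (φψ s⁻))

  rev≡s⁻ : ∀ {d} → rev d ≡ s⁻ → d ≡ s⁺
  rev≡s⁻ {d} e = trans (sym (rev-rev d)) (cong rev e)

  -- Darts, vertices and colours after attaching an ear

  D⁺ V⁺ : Set
  D⁺ = Dart⁺ D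
  V⁺ = Vertex⁺ V

  rev⁺ : D⁺ → D⁺
  rev⁺ (old d) = old (rev d)
  rev⁺ p⁺ = p⁻
  rev⁺ p⁻ = p⁺
  rev⁺ q⁺ = q⁻
  rev⁺ q⁻ = q⁺
  rev⁺ x⁺ = x⁻
  rev⁺ x⁻ = x⁺
  rev⁺ y⁺ = y⁻
  rev⁺ y⁻ = y⁺
  rev⁺ t⁺ = t⁻
  rev⁺ t⁻ = t⁺

  -- The name `s` stays with the piece of the subdivided edge at `u`. Hence only `s⁻`, which used to
  -- start at `v`, gets a new tail.
  oldTail : (d : D) → Dec (d ≡ s⁻) → V⁺
  oldTail d (yes _) = v₁
  oldTail d (no _)  = old (tail d)

  tail⁺ : D⁺ → V⁺
  tail⁺ (old d) = oldTail d (d ≟ s⁻)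
  tail⁺ p⁺ = v₁
  tail⁺ p⁻ = u₁
  tail⁺ q⁺ = u₁
  tail⁺ q⁻ = old (tail s⁻)
  tail⁺ x⁺ = u₁
  tail⁺ x⁻ = v₂
  tail⁺ y⁺ = v₂
  tail⁺ y⁻ = u₂
  tail⁺ t⁺ = u₂
  tail⁺ t⁻ = old (tail s⁻)

  tail-s⁻ : tail⁺ (old s⁻) ≡ v₁
  tail-s⁻ with s⁻ ≟ s⁻
  ... | yes _ = refl
  ... | no ≢ = contradiction refl ≢

  tail-old : ∀ {d} → d ≢ s⁻ → tail⁺ (old d) ≡ old (tail d)
  tail-old {d} d≢ with d ≟ s⁻
  ... | yes d≡ = contradiction d≡ d≢
  ... | no _ = refl

  -- The colours of the new darts depend on the parameter `c`, so decoding compares a colour with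
  -- `c`: the first alternative is the one of colour `c`.
  choose : {A : Set} → Bool → A → A → A
  choose b a a′ = if b xor c then a′ else a

  choose-same : ∀ {A : Set} (a a′ : A) → choose c a a′ ≡ a
  choose-same a a′ rewrite xor-same c = refl

  choose-not : ∀ {A : Set} (a a′ : A) → choose (not c) a a′ ≡ a′
  choose-not a a′ rewrite not-xor c = refl

  -- A dart has the colour of its tail: `v`, `v₁` and `v₂` have colour `c`, while `u`, `u₁` and `u₂`
  -- have the other one.
  encD⁺ : D⁺ → Fin (5 + m) × Bool
  encD⁺ (old d) = let (e , b) = encD d in suc (suc (suc (suc (suc e)))) , b
  encD⁺ p⁺ = 0F , c
  encD⁺ p⁻ = 0F , not c
  encD⁺ q⁺ = 1F , not c
  encD⁺ q⁻ = 1F , c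
  encD⁺ x⁺ = 2F , not c
  encD⁺ x⁻ = 2F , c
  encD⁺ y⁺ = 3F , c
  encD⁺ y⁻ = 3F , not c
  encD⁺ t⁺ = 4F , not c
  encD⁺ t⁻ = 4F , c

  decD⁺ : Fin (5 + m) × Bool → D⁺
  decD⁺ (0F , b) = choose b p⁺ p⁻
  decD⁺ (1F , b) = choose b q⁻ q⁺
  decD⁺ (2F , b) = choose b x⁻ x⁺
  decD⁺ (3F , b) = choose b y⁺ y⁻
  decD⁺ (4F , b) = choose b t⁻ t⁺
  decD⁺ (suc (suc (suc (suc (suc e)))) , b) = old (decD (e , b))

  map-choose : ∀ {A B : Set} (g : A → B) (h : Bool → B) {a a′} → g a ≡ h c → g a′ ≡ h (not c) →
               ∀ b → g (choose b a a′) ≡ h b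
  map-choose g h {a} {a′} e e′ b with same-or-not b c
  ... | inj₁ refl = trans (cong g (choose-same a a′)) e
  ... | inj₂ refl = trans (cong g (choose-not a a′)) e′

  encD-decD⁺ : ∀ i → encD⁺ (decD⁺ i) ≡ i
  encD-decD⁺ (0F , b) = map-choose encD⁺ (0F ,_) refl refl b
  encD-decD⁺ (1F , b) = map-choose encD⁺ (1F ,_) refl refl b
  encD-decD⁺ (2F , b) = map-choose encD⁺ (2F ,_) refl refl b
  encD-decD⁺ (3F , b) = map-choose encD⁺ (3F ,_) refl refl b
  encD-decD⁺ (4F , b) = map-choose encD⁺ (4F ,_) refl refl b
  encD-decD⁺ (suc (suc (suc (suc (suc e)))) , b) rewrite encD-decD (e , b) = refl

  decD-encD⁺ : ∀ d → decD⁺ (encD⁺ d) ≡ d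
  decD-encD⁺ (old d) = cong old (decD-encD d)
  decD-encD⁺ p⁺ = choose-same p⁺ p⁻
  decD-encD⁺ p⁻ = choose-not p⁺ p⁻
  decD-encD⁺ q⁺ = choose-not q⁻ q⁺
  decD-encD⁺ q⁻ = choose-same q⁻ q⁺
  decD-encD⁺ x⁺ = choose-not x⁻ x⁺
  decD-encD⁺ x⁻ = choose-same x⁻ x⁺
  decD-encD⁺ y⁺ = choose-same y⁺ y⁻
  decD-encD⁺ y⁻ = choose-not y⁺ y⁻
  decD-encD⁺ t⁺ = choose-not t⁻ t⁺
  decD-encD⁺ t⁻ = choose-same t⁻ t⁺

  encV⁺ : V⁺ → Fin (2 + l) × Bool
  encV⁺ (old v) = let (i , b) = encV v in suc (suc i) , b
  encV⁺ v₁ = 0F , c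
  encV⁺ u₁ = 0F , not c
  encV⁺ v₂ = 1F , c
  encV⁺ u₂ = 1F , not c

  decV⁺ : Fin (2 + l) × Bool → V⁺
  decV⁺ (0F , b) = choose b v₁ u₁
  decV⁺ (1F , b) = choose b v₂ u₂
  decV⁺ (suc (suc i) , b) = old (decV (i , b))

  encV-decV⁺ : ∀ i → encV⁺ (decV⁺ i) ≡ i
  encV-decV⁺ (0F , b) = map-choose encV⁺ (0F ,_) refl refl b
  encV-decV⁺ (1F , b) = map-choose encV⁺ (1F ,_) refl refl b
  encV-decV⁺ (suc (suc i) , b) rewrite encV-decV (i , b) = refl

  decV-encV⁺ : ∀ v → decV⁺ (encV⁺ v) ≡ v
  decV-encV⁺ (old v) = cong old (decV-encV v)
  decV-encV⁺ v₁ = choose-same v₁ u₁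
  decV-encV⁺ u₁ = choose-not v₁ u₁
  decV-encV⁺ v₂ = choose-same v₂ u₂
  decV-encV⁺ u₂ = choose-not v₂ u₂

  encD-rev⁺ : ∀ d → encD⁺ (rev⁺ d) ≡ (proj₁ (encD⁺ d) , not (proj₂ (encD⁺ d)))
  encD-rev⁺ (old d) rewrite encD-rev d = refl
  encD-rev⁺ p⁺ = refl
  encD-rev⁺ p⁻ = cong (0F ,_) (sym (not-involutive c))
  encD-rev⁺ q⁺ = cong (1F ,_) (sym (not-involutive c))
  encD-rev⁺ q⁻ = refl
  encD-rev⁺ x⁺ = cong (2F ,_) (sym (not-involutive c))
  encD-rev⁺ x⁻ = refl
  encD-rev⁺ y⁺ = refl
  encD-rev⁺ y⁻ = cong (3F ,_) (sym (not-involutive c))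
  encD-rev⁺ t⁺ = cong (4F ,_) (sym (not-involutive c))
  encD-rev⁺ t⁻ = refl

  tail-colour-s⁻ : proj₂ (encV (tail s⁻)) ≡ c
  tail-colour-s⁻ = trans (tail-colour s⁻) colour-s⁻

  tail-colour⁺ : ∀ d → proj₂ (encV⁺ (tail⁺ d)) ≡ proj₂ (encD⁺ d)
  tail-colour⁺ (old d) with d ≟ s⁻
  ... | yes refl = sym colour-s⁻
  ... | no _ = tail-colour d
  tail-colour⁺ p⁺ = refl
  tail-colour⁺ p⁻ = refl
  tail-colour⁺ q⁺ = refl
  tail-colour⁺ q⁻ = tail-colour-s⁻
  tail-colour⁺ x⁺ = refl
  tail-colour⁺ x⁻ = refl
  tail-colour⁺ y⁺ = refl
  tail-colour⁺ y⁻ = refl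
  tail-colour⁺ t⁺ = refl
  tail-colour⁺ t⁻ = tail-colour-s⁻

  -- An ear adds two vertices of each colour and one face, against five edges: two by subdivision
  -- and three on the new path.
  euler⁺ : (2 + l) + (2 + l) + suc (suc n) ≡ (5 + m) + 2
  euler⁺ rewrite +-suc l (suc l) | +-suc l l | +-suc (l + l) (suc n) = cong (5 +_) euler

  -- Two old darts change successor: on the outer walk `s⁺` now stops at `v₁` and continues with
  -- `p⁺`, and on `f` the dart that preceded `s⁻` enters the subdivided edge from `v` through `q⁻`.
  φ-old : (d : D) → Dec (d ≡ s⁺) → Dec (d ≡ ψ s⁻) → D⁺
  φ-old d (yes _) _       = p⁺
  φ-old d (no _)  (yes _) = q⁻
  φ-old d (no _)  (no _)  = old (φ d)

  ψ-old : (d : D) → Dec (d ≡ φ s⁺) → Dec (d ≡ s⁻) → D⁺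
  ψ-old d (yes _) _       = t⁺
  ψ-old d (no _)  (yes _) = p⁻
  ψ-old d (no _)  (no _)  = old (ψ d)

  φ⁺ ψ⁺ : D⁺ → D⁺
  φ⁺ (old d) = φ-old d (d ≟ s⁺) (d ≟ ψ s⁻)
  φ⁺ p⁺ = x⁺
  φ⁺ x⁺ = y⁺
  φ⁺ y⁺ = t⁺
  φ⁺ t⁺ = old (φ s⁺)
  φ⁺ q⁻ = p⁻
  φ⁺ p⁻ = old s⁻
  φ⁺ q⁺ = t⁻
  φ⁺ t⁻ = y⁻
  φ⁺ y⁻ = x⁻
  φ⁺ x⁻ = q⁺
  ψ⁺ (old d) = ψ-old d (d ≟ φ s⁺) (d ≟ s⁻)
  ψ⁺ p⁺ = old s⁺
  ψ⁺ x⁺ = p⁺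
  ψ⁺ y⁺ = x⁺
  ψ⁺ t⁺ = y⁺
  ψ⁺ q⁻ = old (ψ s⁻)
  ψ⁺ p⁻ = q⁻
  ψ⁺ q⁺ = x⁻
  ψ⁺ t⁻ = q⁺
  ψ⁺ y⁻ = t⁻
  ψ⁺ x⁻ = y⁻

  φ-s⁺ : φ⁺ (old s⁺) ≡ p⁺
  φ-s⁺ with s⁺ ≟ s⁺
  ... | yes _ = refl
  ... | no ≢ = contradiction refl ≢

  φ-ψs⁻ : φ⁺ (old (ψ s⁻)) ≡ q⁻
  φ-ψs⁻ with ψ s⁻ ≟ s⁺ | ψ s⁻ ≟ ψ s⁻
  ... | yes e | _     = contradiction e ψs⁻≢s⁺
  ... | no _  | yes _ = refl
  ... | no _  | no ≢  = contradiction refl ≢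

  φ-other : ∀ {d} → d ≢ s⁺ → d ≢ ψ s⁻ → φ⁺ (old d) ≡ old (φ d)
  φ-other {d} d≢ d≢′ with d ≟ s⁺ | d ≟ ψ s⁻
  ... | yes e | _     = contradiction e d≢
  ... | no _  | yes e = contradiction e d≢′
  ... | no _  | no _  = refl

  ψ-φs⁺ : ψ⁺ (old (φ s⁺)) ≡ t⁺
  ψ-φs⁺ with φ s⁺ ≟ φ s⁺
  ... | yes _ = refl
  ... | no ≢ = contradiction refl ≢

  ψ-s⁻ : ψ⁺ (old s⁻) ≡ p⁻
  ψ-s⁻ with s⁻ ≟ φ s⁺ | s⁻ ≟ s⁻
  ... | yes e | _     = contradiction (sym e) φs⁺≢s⁻
  ... | no _  | yes _ = refl
  ... | no _  | no ≢  = contradiction refl ≢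

  ψ-other : ∀ {d} → d ≢ φ s⁺ → d ≢ s⁻ → ψ⁺ (old d) ≡ old (ψ d)
  ψ-other {d} d≢ d≢′ with d ≟ φ s⁺ | d ≟ s⁻
  ... | yes e | _     = contradiction e d≢
  ... | no _  | yes e = contradiction e d≢′
  ... | no _  | no _  = refl

  φψ⁺ : ∀ d → φ⁺ (ψ⁺ d) ≡ d
  φψ⁺ (old d) with d ≟ φ s⁺ | d ≟ s⁻
  ... | yes refl | _        = refl
  ... | no _     | yes refl = refl
  ... | no d≢    | no d≢′   = trans
    (φ-other (λ e → d≢ (trans (sym (φψ d)) (cong φ e)))
             (λ e → d≢′ (trans (sym (φψ d)) (trans (cong φ e) (φψ s⁻)))))
    (cong old (φψ d))
  φψ⁺ p⁺ = φ-s⁺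
  φψ⁺ p⁻ = refl
  φψ⁺ q⁺ = refl
  φψ⁺ q⁻ = φ-ψs⁻
  φψ⁺ x⁺ = refl
  φψ⁺ x⁻ = refl
  φψ⁺ y⁺ = refl
  φψ⁺ y⁻ = refl
  φψ⁺ t⁺ = refl
  φψ⁺ t⁻ = refl

  ψφ⁺ : ∀ d → ψ⁺ (φ⁺ d) ≡ d
  ψφ⁺ (old d) with d ≟ s⁺ | d ≟ ψ s⁻
  ... | yes refl | _        = refl
  ... | no _     | yes refl = refl
  ... | no d≢    | no d≢′   = trans
    (ψ-other (λ e → d≢ (trans (sym (ψφ d)) (trans (cong ψ e) (ψφ s⁺))))
             (λ e → d≢′ (trans (sym (ψφ d)) (cong ψ e))))
    (cong old (ψφ d))
  ψφ⁺ p⁺ = refl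
  ψφ⁺ p⁻ = ψ-s⁻
  ψφ⁺ q⁺ = refl
  ψφ⁺ q⁻ = refl
  ψφ⁺ x⁺ = refl
  ψφ⁺ x⁻ = refl
  ψφ⁺ y⁺ = refl
  ψφ⁺ y⁻ = refl
  ψφ⁺ t⁺ = ψ-φs⁺
  ψφ⁺ t⁻ = refl

  tail-φs⁺ : tail⁺ (old (φ s⁺)) ≡ old (tail s⁻)
  tail-φs⁺ = trans (tail-old φs⁺≢s⁻) (cong old (trans (tail-φ s⁺) (cong tail (rev-rev s⁻))))

  tail-φ⁺ : ∀ d → tail⁺ (φ⁺ d) ≡ tail⁺ (rev⁺ d)
  tail-φ⁺ (old d) with d ≟ s⁺ | d ≟ ψ s⁻
  ... | yes refl | _ = trans (sym tail-s⁻) (cong (tail⁺ ∘ old) (sym (rev-rev s⁻)))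
  ... | no d≢ | yes refl = sym (trans (tail-old (d≢ ∘ rev≡s⁻))
                                 (cong old (trans (sym (tail-φ (ψ s⁻))) (cong tail (φψ s⁻)))))
  ... | no d≢ | no d≢′ = trans (tail-old (λ e → d≢′ (trans (sym (ψφ d)) (cong ψ e))))
                           (trans (cong old (tail-φ d)) (sym (tail-old (d≢ ∘ rev≡s⁻))))
  tail-φ⁺ p⁺ = refl
  tail-φ⁺ p⁻ = tail-s⁻
  tail-φ⁺ q⁺ = refl
  tail-φ⁺ q⁻ = refl
  tail-φ⁺ x⁺ = refl
  tail-φ⁺ x⁻ = refl
  tail-φ⁺ y⁺ = refl
  tail-φ⁺ y⁻ = refl
  tail-φ⁺ t⁺ = tail-φs⁺
  tail-φ⁺ t⁻ = refl

  tail-s⁺ : tail⁺ (old s⁺) ≡ old (tail s⁺)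
  tail-s⁺ = tail-old s⁺≢s⁻

  -- A new vertex has at most one old neighbour, so an old end next to a new one is taken to be that
  -- neighbour without a test. Pairs that are not the ends of an edge may receive any answer.
  find⁺ : V⁺ → V⁺ → Maybe D⁺
  find⁺ (old a) (old b) = mapMaybe old (find a b)
  find⁺ (old _) v₁      = just (old s⁺)
  find⁺ v₁      (old _) = just (old s⁻)
  find⁺ v₁      u₁      = just p⁺
  find⁺ u₁      v₁      = just p⁻
  find⁺ u₁      (old _) = just q⁺
  find⁺ (old _) u₁      = just q⁻
  find⁺ u₁      v₂      = just x⁺
  find⁺ v₂      u₁      = just x⁻
  find⁺ v₂      u₂      = just y⁺
  find⁺ u₂      v₂      = just y⁻
  find⁺ u₂      (old _) = just t⁺
  find⁺ (old _) u₂      = just t⁻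
  find⁺ _       _       = nothing

  find-ends⁺ : ∀ d → find⁺ (tail⁺ d) (tail⁺ (rev⁺ d)) ≡ just d
  find-ends⁺ (old d) with d ≟ s⁻ | rev d ≟ s⁻
  ... | yes refl | yes e = contradiction e s⁺≢s⁻
  ... | yes refl | no _  = refl
  ... | no _     | yes e = cong (just ∘ old) (sym (rev≡s⁻ e))
  ... | no _     | no _  rewrite find-ends d = refl
  find-ends⁺ p⁺ = refl
  find-ends⁺ p⁻ = refl
  find-ends⁺ q⁺ = refl
  find-ends⁺ q⁻ = refl
  find-ends⁺ x⁺ = refl
  find-ends⁺ x⁻ = refl
  find-ends⁺ y⁺ = refl
  find-ends⁺ y⁻ = refl
  find-ends⁺ t⁺ = refl
  find-ends⁺ t⁻ = refl

  Adj⁺ : V⁺ → V⁺ → Set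
  Adj⁺ a b = ∃[ d ] (tail⁺ d ≡ a × tail⁺ (rev⁺ d) ≡ b)

  adj-s⁺ : Adj⁺ (old (tail s⁺)) v₁
  adj-s⁺ = old s⁺ , tail-s⁺ , trans (cong (tail⁺ ∘ old) (rev-rev s⁻)) tail-s⁻

  adj-s⁻ : Adj⁺ v₁ (old (tail s⁺))
  adj-s⁻ = old s⁻ , tail-s⁻ , tail-s⁺

  -- Only the edge between `u` and `v` is gone; it is replaced by the path through `v₁` and `u₁`.
  old-adj : ∀ {a b} → ∃[ d ] (tail d ≡ a × tail (rev d) ≡ b) → Star Adj⁺ (old a) (old b)
  old-adj (d , refl , refl) with d ≟ s⁻ | rev d ≟ s⁻
  ... | yes refl | _ = (q⁻ , refl , refl) ◅ (p⁻ , refl , refl) ◅ adj-s⁻ ◅ ε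
  ... | no _ | yes e rewrite rev≡s⁻ e | rev-rev s⁻ = adj-s⁺ ◅ (p⁺ , refl , refl) ◅ (q⁺ , refl , refl) ◅ ε
  ... | no d≢ | no r≢ = (old d , tail-old d≢ , tail-old r≢) ◅ ε

  old-reach : ∀ v → Star Adj⁺ (old origin) (old v)
  old-reach v = kleisliStar old old-adj (reach v)

  reach-v₁ : Star Adj⁺ (old origin) v₁
  reach-v₁ = old-reach (tail s⁺) ◅◅ adj-s⁺ ◅ ε

  reach⁺ : ∀ v → Star Adj⁺ (old origin) v
  reach⁺ (old v) = old-reach v
  reach⁺ v₁ = reach-v₁
  reach⁺ u₁ = reach-v₁ ◅◅ (p⁺ , refl , refl) ◅ ε
  reach⁺ v₂ = reach-v₁ ◅◅ (p⁺ , refl , refl) ◅ (x⁺ , refl , refl) ◅ ε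
  reach⁺ u₂ = reach-v₁ ◅◅ (p⁺ , refl , refl) ◅ (x⁺ , refl , refl) ◅ (y⁺ , refl , refl) ◅ ε

  -- Rotation around the vertices

  σ⁺ : D⁺ → D⁺
  σ⁺ = φ⁺ ∘ rev⁺

  -- q⁻ takes the place of s⁻ at v.
  atOldTail : D → D⁺
  atOldTail d with d ≟ s⁻
  ... | yes _ = q⁻
  ... | no _  = old d

  atOldTail-s⁻ : atOldTail s⁻ ≡ q⁻
  atOldTail-s⁻ with s⁻ ≟ s⁻
  ... | yes _ = refl
  ... | no ≢ = contradiction refl ≢

  atOldTail-old : ∀ {d} → d ≢ s⁻ → atOldTail d ≡ old d
  atOldTail-old {d} d≢ with d ≟ s⁻
  ... | yes d≡ = contradiction d≡ d≢
  ... | no _ = refl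

  _⟶σ_ _⟶φ_ : D⁺ → D⁺ → Set
  _⟶σ_ = Star (Step σ⁺)
  _⟶φ_ = Star (Step φ⁺)

  t⁻⟶ : t⁻ ⟶σ atOldTail (φ s⁺)
  t⁻⟶ = sym (atOldTail-old φs⁺≢s⁻) ◅ ε

  -- Around `v` the single dart `s⁻` gives way to `q⁻` followed by `t⁻`. The step out of `s⁻`
  -- therefore becomes two steps, the step into `s⁻` ends at `q⁻`, and all others survive as they
  -- are.
  σ-lift : ∀ {d d′} → Step σ d d′ → atOldTail d ⟶σ atOldTail d′
  σ-lift {d} refl = go (d ≟ s⁻) (rev d ≟ ψ s⁻)
    where
    go : Dec (d ≡ s⁻) → Dec (rev d ≡ ψ s⁻) → atOldTail d ⟶σ atOldTail (σ d)
    go (yes refl) _ = subst (_⟶σ atOldTail (φ s⁺)) (sym atOldTail-s⁻) (refl ◅ t⁻⟶)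
    go (no d≢) (yes e) = subst (_⟶σ atOldTail (σ d)) (sym (atOldTail-old d≢))
      (trans (trans (cong (φ⁺ ∘ old) e) φ-ψs⁻)
             (sym (trans (cong atOldTail (trans (cong φ e) (φψ s⁻))) atOldTail-s⁻)) ◅ ε)
    go (no d≢) (no r≢) = subst (_⟶σ atOldTail (σ d)) (sym (atOldTail-old d≢))
      (trans (φ-other (d≢ ∘ rev≡s⁺) r≢)
             (sym (atOldTail-old (λ e → r≢ (trans (sym (ψφ (rev d))) (cong ψ e))))) ◅ ε)
      where
      rev≡s⁺ : rev d ≡ s⁺ → d ≡ s⁻
      rev≡s⁺ e = trans (sym (rev-rev d)) (trans (cong rev e) (rev-rev s⁻))

  σ-lift* : ∀ {d d′} → Star (Step σ) d d′ → atOldTail d ⟶σ atOldTail d′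
  σ-lift* = kleisliStar atOldTail σ-lift

  dartAt⁺ : V⁺ → D⁺
  dartAt⁺ (old v) = atOldTail (dartAt v)
  dartAt⁺ v₁ = p⁺
  dartAt⁺ u₁ = x⁺
  dartAt⁺ v₂ = y⁺
  dartAt⁺ u₂ = y⁻

  q⁻⟶dartAt : q⁻ ⟶σ dartAt⁺ (old (tail s⁻))
  q⁻⟶dartAt = subst (_⟶σ dartAt⁺ (old (tail s⁻))) atOldTail-s⁻ (σ-lift* (toDartAt s⁻))

  dartAt⟶q⁻ : dartAt⁺ (old (tail s⁻)) ⟶σ q⁻
  dartAt⟶q⁻ = subst (dartAt⁺ (old (tail s⁻)) ⟶σ_) atOldTail-s⁻ (σ-lift* (fromDartAt s⁻))

  toDartAt⁺ : ∀ d → d ⟶σ dartAt⁺ (tail⁺ d)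
  toDartAt⁺ (old d) with d ≟ s⁻
  ... | yes refl = φ-s⁺ ◅ ε
  ... | no d≢ = subst (_⟶σ atOldTail (dartAt (tail d))) (atOldTail-old d≢) (σ-lift* (toDartAt d))
  toDartAt⁺ p⁺ = ε
  toDartAt⁺ p⁻ = refl ◅ ε
  toDartAt⁺ q⁺ = refl ◅ refl ◅ ε
  toDartAt⁺ q⁻ = q⁻⟶dartAt
  toDartAt⁺ x⁺ = ε
  toDartAt⁺ x⁻ = refl ◅ ε
  toDartAt⁺ y⁺ = ε
  toDartAt⁺ y⁻ = ε
  toDartAt⁺ t⁺ = refl ◅ ε
  toDartAt⁺ t⁻ = t⁻⟶ ◅◅ σ-lift* (subst (λ v → Star (Step σ) (φ s⁺) (dartAt v))
    (trans (tail-φ s⁺) (cong tail (rev-rev s⁻))) (toDartAt (φ s⁺)))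

  fromDartAt⁺ : ∀ d → dartAt⁺ (tail⁺ d) ⟶σ d
  fromDartAt⁺ (old d) with d ≟ s⁻
  ... | yes refl = refl ◅ ε
  ... | no d≢ = subst (atOldTail (dartAt (tail d)) ⟶σ_) (atOldTail-old d≢) (σ-lift* (fromDartAt d))
  fromDartAt⁺ p⁺ = ε
  fromDartAt⁺ p⁻ = refl ◅ refl ◅ ε
  fromDartAt⁺ q⁺ = refl ◅ ε
  fromDartAt⁺ q⁻ = dartAt⟶q⁻
  fromDartAt⁺ x⁺ = ε
  fromDartAt⁺ x⁻ = refl ◅ ε
  fromDartAt⁺ y⁺ = ε
  fromDartAt⁺ y⁻ = ε
  fromDartAt⁺ t⁺ = refl ◅ ε
  fromDartAt⁺ t⁻ = dartAt⟶q⁻ ◅◅ (refl ◅ ε)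

  -- Faces and their boundary walks

  face⁺ : D⁺ → Fin (suc (suc n))
  face⁺ (old d) = liftFace (face d)
  face⁺ p⁺ = zero
  face⁺ p⁻ = suc (suc f)
  face⁺ q⁺ = suc zero
  face⁺ q⁻ = suc (suc f)
  face⁺ x⁺ = zero
  face⁺ x⁻ = suc zero
  face⁺ y⁺ = zero
  face⁺ y⁻ = suc zero
  face⁺ t⁺ = zero
  face⁺ t⁻ = suc zero

  face-φ⁺ : ∀ d → face⁺ (φ⁺ d) ≡ face⁺ d
  face-φ⁺ (old d) with d ≟ s⁺ | d ≟ ψ s⁻
  ... | yes refl | _ = sym (cong liftFace face-s⁺)
  ... | no _ | yes refl = sym (cong liftFace (trans (sym (face-φ (ψ s⁻))) (trans (cong face (φψ s⁻)) face-s⁻)))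
  ... | no _ | no _ = cong liftFace (face-φ d)
  face-φ⁺ p⁺ = refl
  face-φ⁺ p⁻ = cong liftFace face-s⁻
  face-φ⁺ q⁺ = refl
  face-φ⁺ q⁻ = refl
  face-φ⁺ x⁺ = refl
  face-φ⁺ x⁻ = refl
  face-φ⁺ y⁺ = refl
  face-φ⁺ y⁻ = refl
  face-φ⁺ t⁺ = cong liftFace (trans (face-φ s⁺) face-s⁺)
  face-φ⁺ t⁻ = refl

  -- The step out of `s⁺` becomes a detour along `p⁺`, `x⁺`, `y⁺`, `t⁺`, and the step into `s⁻` a
  -- detour along `q⁻`, `p⁻`.
  φ-lift : ∀ {d d′} → Step φ d d′ → old d ⟶φ old d′
  φ-lift {d} refl = go (d ≟ s⁺) (d ≟ ψ s⁻)
    where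
    go : Dec (d ≡ s⁺) → Dec (d ≡ ψ s⁻) → old d ⟶φ old (φ d)
    go (yes refl) _ = φ-s⁺ ◅ refl ◅ refl ◅ refl ◅ refl ◅ ε
    go (no _) (yes refl) = φ-ψs⁻ ◅ refl ◅ cong old (sym (φψ s⁻)) ◅ ε
    go (no d≢) (no d≢′) = φ-other d≢ d≢′ ◅ ε

  φ-lift* : ∀ {d d′} → Star (Step φ) d d′ → old d ⟶φ old d′
  φ-lift* = kleisliStar old φ-lift

  dartOn⁺ : Fin (suc (suc n)) → D⁺
  dartOn⁺ zero          = old (dartOn zero)
  dartOn⁺ (suc zero)    = q⁺
  dartOn⁺ (suc (suc x)) = old (dartOn (suc x))

  dartOn-lift : ∀ g → dartOn⁺ (liftFace g) ≡ old (dartOn g)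
  dartOn-lift zero    = refl
  dartOn-lift (suc x) = refl

  face-dartOn⁺ : ∀ g → face⁺ (dartOn⁺ g) ≡ g
  face-dartOn⁺ zero          = cong liftFace (face-dartOn zero)
  face-dartOn⁺ (suc zero)    = refl
  face-dartOn⁺ (suc (suc x)) = cong liftFace (face-dartOn (suc x))

  to-old : ∀ {g} d → face d ≡ g → old d ⟶φ old (dartOn g)
  to-old d refl = φ-lift* (toDartOn d)

  from-old : ∀ {g} d → face d ≡ g → old (dartOn g) ⟶φ old d
  from-old d refl = φ-lift* (fromDartOn d)

  toDartOn⁺ : ∀ d → d ⟶φ dartOn⁺ (face⁺ d)
  toDartOn⁺ (old d) = subst (old d ⟶φ_) (sym (dartOn-lift (face d))) (to-old d refl)
  toDartOn⁺ t⁺ = refl ◅ to-old (φ s⁺) (trans (face-φ s⁺) face-s⁺)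
  toDartOn⁺ y⁺ = refl ◅ toDartOn⁺ t⁺
  toDartOn⁺ x⁺ = refl ◅ refl ◅ toDartOn⁺ t⁺
  toDartOn⁺ p⁺ = refl ◅ refl ◅ refl ◅ toDartOn⁺ t⁺
  toDartOn⁺ p⁻ = refl ◅ to-old s⁻ face-s⁻
  toDartOn⁺ q⁻ = refl ◅ refl ◅ to-old s⁻ face-s⁻
  toDartOn⁺ q⁺ = ε
  toDartOn⁺ x⁻ = refl ◅ ε
  toDartOn⁺ y⁻ = refl ◅ refl ◅ ε
  toDartOn⁺ t⁻ = refl ◅ refl ◅ refl ◅ ε

  fromDartOn⁺ : ∀ d → dartOn⁺ (face⁺ d) ⟶φ d
  fromDartOn⁺ (old d) = subst (_⟶φ old d) (sym (dartOn-lift (face d))) (from-old d refl)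
  fromDartOn⁺ p⁺ = from-old s⁺ face-s⁺ ◅◅ φ-s⁺ ◅ ε
  fromDartOn⁺ x⁺ = fromDartOn⁺ p⁺ ◅◅ refl ◅ ε
  fromDartOn⁺ y⁺ = fromDartOn⁺ p⁺ ◅◅ refl ◅ refl ◅ ε
  fromDartOn⁺ t⁺ = fromDartOn⁺ p⁺ ◅◅ refl ◅ refl ◅ refl ◅ ε
  fromDartOn⁺ q⁻ = from-old (ψ s⁻) (trans (sym (face-φ (ψ s⁻))) (trans (cong face (φψ s⁻)) face-s⁻)) ◅◅ φ-ψs⁻ ◅ ε
  fromDartOn⁺ p⁻ = fromDartOn⁺ q⁻ ◅◅ refl ◅ ε
  fromDartOn⁺ q⁺ = ε
  fromDartOn⁺ x⁻ = refl ◅ refl ◅ refl ◅ ε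
  fromDartOn⁺ y⁻ = refl ◅ refl ◅ ε
  fromDartOn⁺ t⁻ = refl ◅ ε

  face-rev⁺ : ∀ d → face⁺ (rev⁺ d) ≢ face⁺ d
  face-rev⁺ (old d) e = face-rev d (liftFace-injective _ _ e)

  -- Values matter only at vertices of the given face. The only old vertex of the leaf's face is
  -- `v`, and among the older inner faces only `f` contains `v₁` and `u₁`, so neither the old vertex
  -- nor the older face is tested.
  at⁺ : Fin (suc n) → V⁺ → Maybe D⁺
  at⁺ zero    (old _) = just t⁻
  at⁺ zero    v₁      = nothing
  at⁺ zero    u₁      = just q⁺
  at⁺ zero    v₂      = just x⁻
  at⁺ zero    u₂      = just y⁻
  at⁺ (suc x) (old v) = mapMaybe atOldTail (at x v)
  at⁺ (suc x) v₁      = just (old s⁻)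
  at⁺ (suc x) u₁      = just p⁻
  at⁺ (suc x) v₂      = nothing
  at⁺ (suc x) u₂      = nothing

  at-tail⁺ : ∀ {x} d → face⁺ d ≡ suc x → at⁺ x (tail⁺ d) ≡ just d
  at-tail⁺ (old d) e with face d in eq
  at-tail⁺ (old d) refl | suc x with d ≟ s⁻
  ... | yes refl = refl
  ... | no d≢ rewrite at-tail d eq = cong just (atOldTail-old d≢)
  at-tail⁺ p⁻ refl = refl
  at-tail⁺ q⁺ refl = refl
  at-tail⁺ q⁻ refl rewrite at-tail s⁻ face-s⁻ = cong just atOldTail-s⁻
  at-tail⁺ x⁻ refl = refl
  at-tail⁺ y⁻ refl = refl
  at-tail⁺ t⁻ refl = refl

  -- The edge shared with the leaf is `q`, so `s` is still an outer edge of `f` and every older face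
  -- keeps its sides.
  side⁺ : Fin (suc n) → Bool → D⁺
  side⁺ zero    b = choose b x⁻ y⁻
  side⁺ (suc x) b = old (side x b)

  side-colour⁺ : ∀ x b → proj₂ (encD⁺ (side⁺ x b)) ≡ b
  side-colour⁺ zero    b = map-choose (proj₂ ∘ encD⁺) (λ b → b) refl refl b
  side-colour⁺ (suc x) b = side-colour x b

  side-face⁺ : ∀ x b → face⁺ (side⁺ x b) ≡ suc x
  side-face⁺ zero    b = map-choose face⁺ (λ _ → suc zero) {x⁻} {y⁻} refl refl b
  side-face⁺ (suc x) b = cong liftFace (side-face x b)

  side-outer⁺ : ∀ x b → face⁺ (rev⁺ (side⁺ x b)) ≡ zero
  side-outer⁺ zero    b = map-choose (face⁺ ∘ rev⁺) (λ _ → zero) {x⁻} {y⁻} refl refl b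
  side-outer⁺ (suc x) b = cong liftFace (side-outer x b)

  -- Among the new edges only `q` separates two inner faces. Its black-to-white dart is `q⁻` when
  -- `c` is `false` and `q⁺` when `c` is `true`; this is how the colour of the side encodes the
  -- direction of the tree edge.
  face-arc⁺ : ∀ {u v} d → proj₂ (encD⁺ d) ≡ false → face⁺ d ≡ suc u → face⁺ (rev⁺ d) ≡ suc v →
              CodeArc (ext C f c) v u
  face-arc⁺ (old d) black e e′ with face d in eq | face (rev d) in eq′
  face-arc⁺ (old d) black refl refl | suc _ | suc _ = keep (face-arc d black eq eq′)
  face-arc⁺ q⁺ black refl refl = new→ black
    where
    new→ : ∀ {c} → not c ≡ false → CodeArc (ext C f c) (suc f) zero
    new→ {true} _ = parent→leaf
  face-arc⁺ q⁻ refl refl refl = leaf→parent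

  -- Perfect matchings across an ear

  Symmetric⁺ : (D⁺ → Bool) → Set
  Symmetric⁺ M = ∀ d → M (rev⁺ d) ≡ M d

  -- The conditions at `v₁`, `u₁`, `v₂` and `u₂`, solved in terms of `s` and `x`. For the matching
  -- of a set `S`, the remaining implication `x⇒s` says that `S` is closed along the new tree edge.
  record EarValues (M : D⁺ → Bool) : Set where
    field
      p-value : M p⁻ ≡ not (M (old s⁻))
      q-value : M q⁻ ≡ M (old s⁻) ∧ not (M x⁻)
      y-value : M y⁻ ≡ not (M x⁻)
      t-value : M t⁻ ≡ M x⁻
      x⇒s     : M x⁻ ≡ true → M (old s⁻) ≡ true

  at-v₁ : ∀ d → tail⁺ d ≡ v₁ → d ≡ old s⁻ ⊎ d ≡ p⁺
  at-v₁ (old d) e with d ≟ s⁻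
  ... | yes refl = inj₁ refl
  at-v₁ p⁺ _ = inj₂ refl

  at-u₁ : ∀ d → tail⁺ d ≡ u₁ → d ≡ p⁻ ⊎ d ≡ q⁺ ⊎ d ≡ x⁺
  at-u₁ (old d) e with d ≟ s⁻
  at-u₁ (old d) () | yes _
  at-u₁ (old d) () | no _
  at-u₁ p⁻ _ = inj₁ refl
  at-u₁ q⁺ _ = inj₂ (inj₁ refl)
  at-u₁ x⁺ _ = inj₂ (inj₂ refl)

  at-v₂ : ∀ d → tail⁺ d ≡ v₂ → d ≡ x⁻ ⊎ d ≡ y⁺
  at-v₂ (old d) e with d ≟ s⁻
  at-v₂ (old d) () | yes _
  at-v₂ (old d) () | no _
  at-v₂ x⁻ _ = inj₁ refl
  at-v₂ y⁺ _ = inj₂ refl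

  at-u₂ : ∀ d → tail⁺ d ≡ u₂ → d ≡ y⁻ ⊎ d ≡ t⁺
  at-u₂ (old d) e with d ≟ s⁻
  at-u₂ (old d) () | yes _
  at-u₂ (old d) () | no _
  at-u₂ y⁻ _ = inj₁ refl
  at-u₂ t⁺ _ = inj₂ refl

  data AtOld (w : V) : D⁺ → Set where
    is-old : ∀ {d} → d ≢ s⁻ → tail d ≡ w → AtOld w (old d)
    is-q   : tail s⁻ ≡ w → AtOld w q⁻
    is-t   : tail s⁻ ≡ w → AtOld w t⁻

  at-old : ∀ {w} d → tail⁺ d ≡ old w → AtOld w d
  at-old (old d) e with d ≟ s⁻
  at-old (old d) refl | no d≢ = is-old d≢ refl
  at-old q⁻ refl = is-q refl
  at-old t⁻ refl = is-t refl

  module _ {M : D⁺ → Bool} (symm : Symmetric⁺ M) where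

    perfect⇒earValues : Perfect tail⁺ M → EarValues M
    perfect⇒earValues P = record
      { p-value = p-value
      ; q-value = trans (symm q⁺) (trans (proj₁ three)
          (cong₂ _∧_ (trans (cong not p-value) (not-involutive _)) (cong not (sym (symm x⁺)))))
      ; y-value = y-value
      ; t-value = trans (symm t⁺) (trans (two⇒ refl refl at-u₂ (λ ()) (P u₂)) (trans (cong not y-value) (not-involutive _)))
      ; x⇒s = λ e → trans (sym (not-involutive _)) (cong not (trans (sym p-value) (proj₂ three (trans (sym (symm x⁺)) e))))
      }
      where
      p-value : M p⁻ ≡ not (M (old s⁻))
      p-value = trans (symm p⁺) (two⇒ tail-s⁻ refl at-v₁ (λ ()) (P v₁))
      y-value : M y⁻ ≡ not (M x⁻)
      y-value = trans (symm y⁺) (two⇒ refl refl at-v₂ (λ ()) (P v₂))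
      three = three⇒ refl refl refl at-u₁ (λ ()) (λ ()) (λ ()) (P u₁)

    module _ (E : EarValues M) where
      open EarValues E

      -- This and the next three facts say that at `v` exactly one of `q⁻`, `t⁻` is matched if `s⁻`
      -- is, and none otherwise. Perfectness at `v` therefore passes between the old map and the new
      -- one.
      q⇒s : M q⁻ ≡ true → M (old s⁻) ≡ true
      q⇒s e with M (old s⁻) | trans (sym q-value) e
      ... | true | _ = refl

      t⇒s : M t⁻ ≡ true → M (old s⁻) ≡ true
      t⇒s e = x⇒s (trans (sym t-value) e)

      s⇒q⊎t : M (old s⁻) ≡ true → M q⁻ ≡ true ⊎ M t⁻ ≡ true
      s⇒q⊎t e with M x⁻ | q-value | t-value
      ... | true  | _  | et = inj₂ et
      ... | false | eq | _  = inj₁ (trans eq (trans (∧-identityʳ _) e))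

      ¬q∧t : M q⁻ ≡ true → M t⁻ ≡ true → ⊥
      ¬q∧t eq et with trans (sym eq) (trans q-value (cong (λ b → M (old s⁻) ∧ not b) (trans (sym t-value) et)))
      ... | e with M (old s⁻)
      ¬q∧t eq et | () | true
      ¬q∧t eq et | () | false

      perfect-old : Perfect tail⁺ M → Perfect tail (M ∘ old)
      perfect-old P w with P (old w)
      ... | d , dw , dM , uniq = go d (at-old d dw) dM uniq
        where
        go : ∀ d → AtOld w d → M d ≡ true → (∀ d′ → tail⁺ d′ ≡ old w → M d′ ≡ true → d′ ≡ d) →
             ExactlyOne tail (M ∘ old) w
        go (old d) (is-old d≢ dw) dM uniq = d , dw , dM , λ d′ → unique d′ (d′ ≟ s⁻)
          where
          unique : ∀ d′ → Dec (d′ ≡ s⁻) → tail d′ ≡ w → M (old d′) ≡ true → d′ ≡ d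
          unique d′ (no ≢) d′w d′M = old-injective (uniq (old d′) (trans (tail-old ≢) (cong old d′w)) d′M)
          unique d′ (yes refl) d′w d′M with s⇒q⊎t d′M
          ... | inj₁ qM = contradiction (uniq q⁻ (cong old d′w) qM) λ ()
          ... | inj₂ tM = contradiction (uniq t⁻ (cong old d′w) tM) λ ()
        go q⁻ (is-q vw) dM uniq = s⁻ , vw , q⇒s dM , λ d′ → unique d′ (d′ ≟ s⁻)
          where
          unique : ∀ d′ → Dec (d′ ≡ s⁻) → tail d′ ≡ w → M (old d′) ≡ true → d′ ≡ s⁻
          unique d′ (yes e) _ _ = e
          unique d′ (no ≢) d′w d′M = contradiction (uniq (old d′) (trans (tail-old ≢) (cong old d′w)) d′M) λ ()
        go t⁻ (is-t vw) dM uniq = s⁻ , vw , t⇒s dM , λ d′ → unique d′ (d′ ≟ s⁻)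
          where
          unique : ∀ d′ → Dec (d′ ≡ s⁻) → tail d′ ≡ w → M (old d′) ≡ true → d′ ≡ s⁻
          unique d′ (yes e) _ _ = e
          unique d′ (no ≢) d′w d′M = contradiction (uniq (old d′) (trans (tail-old ≢) (cong old d′w)) d′M) λ ()

      perfect⁺ : Perfect tail (M ∘ old) → Perfect tail⁺ M
      perfect⁺ P v₁ = two⇐ tail-s⁻ refl at-v₁ (trans (sym (symm p⁺)) p-value)
      perfect⁺ P u₁ = three⇐ refl refl refl at-u₁
        (trans (sym (symm q⁺)) (trans q-value (cong₂ _∧_
          (trans (sym (not-involutive _)) (cong not (sym p-value))) (cong not (symm x⁺)))))
        (λ e → trans p-value (cong not (x⇒s (trans (symm x⁺) e))))
      perfect⁺ P v₂ = two⇐ refl refl at-v₂ (trans (sym (symm y⁺)) y-value)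
      perfect⁺ P u₂ = two⇐ refl refl at-u₂ (trans (sym (symm t⁺))
        (trans t-value (trans (sym (not-involutive _)) (cong not (sym y-value)))))
      perfect⁺ P (old w) with P w
      ... | d , dw , dM , uniq = go (d ≟ s⁻)
        where
        go : Dec (d ≡ s⁻) → ExactlyOne tail⁺ M (old w)
        go (no d≢) = old d , trans (tail-old d≢) (cong old dw) , dM , λ d′ d′w → unique (at-old d′ d′w)
          where
          unique : ∀ {d′} → AtOld w d′ → M d′ ≡ true → d′ ≡ old d
          unique (is-old _ d′w) d′M = cong old (uniq _ d′w d′M)
          unique (is-q vw) qM = contradiction (sym (uniq s⁻ vw (q⇒s qM))) d≢
          unique (is-t vw) tM = contradiction (sym (uniq s⁻ vw (t⇒s tM))) d≢
        go (yes refl) with s⇒q⊎t dM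
        ... | inj₁ qM = q⁻ , cong old dw , qM , λ d′ d′w → unique (at-old d′ d′w)
          where
          unique : ∀ {d′} → AtOld w d′ → M d′ ≡ true → d′ ≡ q⁻
          unique (is-old ≢ d′w) d′M = contradiction (uniq _ d′w d′M) ≢
          unique (is-q _) _ = refl
          unique (is-t _) tM = ⊥-elim (¬q∧t qM tM)
        ... | inj₂ tM = t⁻ , cong old dw , tM , λ d′ d′w → unique (at-old d′ d′w)
          where
          unique : ∀ {d′} → AtOld w d′ → M d′ ≡ true → d′ ≡ t⁻
          unique (is-old ≢ d′w) d′M = contradiction (uniq _ d′w d′M) ≢
          unique (is-q _) qM = ⊥-elim (¬q∧t qM tM)
          unique (is-t _) _ = refl

  matching⁺ : (Fin (suc n) → Bool) → D⁺ → Bool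
  matching⁺ S d = edgeValue S (proj₂ (encD⁺ d)) (face⁺ d) (face⁺ (rev⁺ d))

  matching-old : ∀ S d → matching⁺ S (old d) ≡ matching (S ∘ suc) d
  matching-old S d = edgeValue-lift S (colour d) (face d) (face (rev d))

  matching-symmetric⁺ : ∀ S → Symmetric⁺ (matching⁺ S)
  matching-symmetric⁺ S (old d) = trans (matching-old S (rev d))
    (trans (matching-symmetric (S ∘ suc) d) (sym (matching-old S d)))
  matching-symmetric⁺ S p⁺ = edgeValue-swap S c _ _
  matching-symmetric⁺ S p⁻ = sym (edgeValue-swap S c _ _)
  matching-symmetric⁺ S q⁺ = sym (edgeValue-swap S c _ _)
  matching-symmetric⁺ S q⁻ = edgeValue-swap S c _ _
  matching-symmetric⁺ S x⁺ = sym (edgeValue-swap S c _ _)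
  matching-symmetric⁺ S x⁻ = edgeValue-swap S c _ _
  matching-symmetric⁺ S y⁺ = edgeValue-swap S c _ _
  matching-symmetric⁺ S y⁻ = sym (edgeValue-swap S c _ _)
  matching-symmetric⁺ S t⁺ = sym (edgeValue-swap S c _ _)
  matching-symmetric⁺ S t⁻ = edgeValue-swap S c _ _

  module _ (S : Fin (suc n) → Bool) where

    s-matching : matching⁺ S (old s⁻) ≡ c xor S (suc f)
    s-matching = trans (matching-old S s⁻)
      (trans (matching-side (S ∘ suc) s⁻ face-s⁻ face-s⁺) (cong (_xor S (suc f)) colour-s⁻))

    x-matching : matching⁺ S x⁻ ≡ c xor S zero
    x-matching = edgeValue-outer S c zero

    q-edge : ∀ c → edgeValue S c (suc (suc f)) (suc zero) ≡ (c xor S (suc f)) ∧ not (c xor S zero)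
    q-edge true  = trans (∧-comm (S zero) _) (cong (not (S (suc f)) ∧_) (sym (not-involutive _)))
    q-edge false = refl

    matching-earValues : (c xor S zero ≡ true → c xor S (suc f) ≡ true) → EarValues (matching⁺ S)
    matching-earValues x⇒s = record
      { p-value = trans (edgeValue-outer S (not c) (suc f)) (trans (not-xorˡ c _) (cong not (sym s-matching)))
      ; q-value = trans (q-edge c) (cong₂ (λ a b → a ∧ not b) (sym s-matching) (sym x-matching))
      ; y-value = trans (edgeValue-outer S (not c) zero) (trans (not-xorˡ c _) (cong not (sym x-matching)))
      ; t-value = refl
      ; x⇒s     = λ e → trans s-matching (x⇒s (trans (sym x-matching) e))
      }

  -- For `c` equal to `true` the `xor` negates both sides, and the implication is the contrapositive
  -- of closure along the arc from parent to leaf.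
  closed⇒ : ∀ {S} c → Closed (ext C f c) S → c xor S zero ≡ true → c xor S (suc f) ≡ true
  closed⇒ {S} true S↓ e with S (suc f) in eq
  ... | false = refl
  ... | true  = trans (sym (cong not (S↓ parent→leaf eq))) e
  closed⇒ false S↓ e = S↓ leaf→parent e

  closed⇐ : ∀ {S} c → Closed C (S ∘ suc) → (c xor S zero ≡ true → c xor S (suc f) ≡ true) → Closed (ext C f c) S
  closed⇐ c S↓ x⇒s (keep uv) Su = S↓ uv Su
  closed⇐ false S↓ x⇒s leaf→parent Su = x⇒s Su
  closed⇐ {S} true S↓ x⇒s parent→leaf Su with S zero
  ... | true  = refl
  ... | false = trans (sym (cong not Su)) (x⇒s refl)

  matching-perfect⁺ : ∀ S → Closed (ext C f c) S → Perfect tail⁺ (matching⁺ S)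
  matching-perfect⁺ S S↓ = perfect⁺ (matching-symmetric⁺ S) (matching-earValues S (closed⇒ c S↓))
    (perfect-resp (matching-old S) (matching-perfect (S ∘ suc) (S↓ ∘ keep)))

  module _ (M : D⁺ → Bool) (symm : Symmetric⁺ M) (P : Perfect tail⁺ M) where

    private
      E : EarValues M
      E = perfect⇒earValues symm P
      S : Fin (suc n) → Bool
      S x = M (side⁺ x false)
      P-old : Perfect tail (M ∘ old)
      P-old = perfect-old symm E P

    open EarValues E

    old-values : ∀ d → M (old d) ≡ matching⁺ S (old d)
    old-values d = trans (matching-downSet (M ∘ old) (symm ∘ old) P-old d) (sym (matching-old S d))

    -- `S zero` is read off the black side of the leaf's face, which is `x⁻` or, for `c` equal to
    -- `true`, `y⁻`, whose value is the negation. The copy `c′` can be matched on where the module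
    -- parameter cannot.
    x-as-S : ∀ c′ → c′ ≡ c → M x⁻ ≡ c′ xor S zero
    x-as-S true refl = trans (sym (not-involutive _)) (cong not (sym y-value))
    x-as-S false refl = refl

    x-S : M x⁻ ≡ c xor S zero
    x-S = x-as-S c refl

    s-S : M (old s⁻) ≡ c xor S (suc f)
    s-S = trans (old-values s⁻) (s-matching S)

    private
      E′ : EarValues (matching⁺ S)
      E′ = matching-earValues S (λ e → trans (sym s-S) (x⇒s (trans x-S e)))
      module E′ = EarValues E′
      sᵉ : M (old s⁻) ≡ matching⁺ S (old s⁻)
      sᵉ = old-values s⁻
      xᵉ : M x⁻ ≡ matching⁺ S x⁻
      xᵉ = trans x-S (sym (x-matching S))

    flip-value : ∀ d → M d ≡ matching⁺ S d → M (rev⁺ d) ≡ matching⁺ S (rev⁺ d)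
    flip-value d e = trans (symm d) (trans e (sym (matching-symmetric⁺ S d)))

    -- `M` and the matching of `S` both satisfy `EarValues` and agree on `s` and `x`, hence on the
    -- whole ear.
    matching-downSet⁺ : ∀ d → M d ≡ matching⁺ S d
    matching-downSet⁺ (old d) = old-values d
    matching-downSet⁺ p⁻ = trans p-value (trans (cong not sᵉ) (sym E′.p-value))
    matching-downSet⁺ q⁻ = trans q-value (trans (cong₂ (λ a b → a ∧ not b) sᵉ xᵉ) (sym E′.q-value))
    matching-downSet⁺ x⁻ = xᵉ
    matching-downSet⁺ y⁻ = trans y-value (trans (cong not xᵉ) (sym E′.y-value))
    matching-downSet⁺ t⁻ = trans t-value (trans xᵉ (sym E′.t-value))
    matching-downSet⁺ p⁺ = flip-value p⁻ (matching-downSet⁺ p⁻)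
    matching-downSet⁺ q⁺ = flip-value q⁻ (matching-downSet⁺ q⁻)
    matching-downSet⁺ x⁺ = flip-value x⁻ (matching-downSet⁺ x⁻)
    matching-downSet⁺ y⁺ = flip-value y⁻ (matching-downSet⁺ y⁻)
    matching-downSet⁺ t⁺ = flip-value t⁻ (matching-downSet⁺ t⁻)

    downSet-closed⁺ : Closed (ext C f c) S
    downSet-closed⁺ = closed⇐ c (downSet-closed (M ∘ old) (symm ∘ old) P-old)
      (λ e → trans (sym s-S) (x⇒s (trans x-S e)))

  extended : PlaneMap (ext C f c)
  extended = record
    { D = D⁺ ; V = V⁺ ; m = 5 + m ; l = 2 + l
    ; encD = encD⁺ ; decD = decD⁺ ; encD-decD = encD-decD⁺ ; decD-encD = decD-encD⁺
    ; encV = encV⁺ ; decV = decV⁺ ; encV-decV = encV-decV⁺ ; decV-encV = decV-encV⁺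
    ; rev = rev⁺ ; encD-rev = encD-rev⁺ ; tail = tail⁺ ; euler = euler⁺
    ; tail-colour = tail-colour⁺
    ; φ = φ⁺ ; ψ = ψ⁺ ; φψ = φψ⁺ ; ψφ = ψφ⁺ ; tail-φ = tail-φ⁺
    ; find = find⁺ ; find-ends = find-ends⁺
    ; origin = old origin ; reach = reach⁺
    ; dartAt = dartAt⁺ ; toDartAt = toDartAt⁺ ; fromDartAt = fromDartAt⁺
    ; face = face⁺ ; face-φ = face-φ⁺
    ; dartOn = dartOn⁺ ; face-dartOn = face-dartOn⁺ ; toDartOn = toDartOn⁺ ; fromDartOn = fromDartOn⁺
    ; face-rev = face-rev⁺ ; at = at⁺ ; at-tail = at-tail⁺
    ; side = side⁺ ; side-colour = side-colour⁺ ; side-face = side-face⁺ ; side-outer = side-outer⁺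
    ; face-arc = face-arc⁺
    ; matching-perfect = matching-perfect⁺
    ; downSet-closed = downSet-closed⁺
    ; matching-downSet = matching-downSet⁺
    }

planeMap : ∀ {n} (C : Code n) → PlaneMap C
planeMap single      = Square.square
planeMap (ext C f c) = Ear.extended (planeMap C) f c

-- From plane maps to plane bipartite graphs

iter-shift : ∀ {A : Set} (f : A → A) j x → iter f j (f x) ≡ f (iter f j x)
iter-shift f zero    x = refl
iter-shift f (suc j) x = cong f (iter-shift f j x)

orbit⇒iter : ∀ {A : Set} {f : A → A} {x y} → Star (Step f) x y → ∃[ j ] iter f j x ≡ y
orbit⇒iter ε = 0 , refl
orbit⇒iter {f = f} (refl ◅ p) with orbit⇒iter p
... | j , e = suc j , trans (sym (iter-shift f j _)) e

iter-conj : ∀ {A B : Set} {f : A → A} {g : B → B} (h : A → B) → (∀ x → g (h x) ≡ h (f x)) →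
            ∀ j x → iter g j (h x) ≡ h (iter f j x)
iter-conj h e zero    x = refl
iter-conj {g = g} h e (suc j) x = trans (cong g (iter-conj h e j x)) (e _)

iter-invariant : ∀ {A B : Set} {f : A → A} (h : A → B) → (∀ x → h (f x) ≡ h x) → ∀ j x → h (iter f j x) ≡ h x
iter-invariant h e zero    x = refl
iter-invariant h e (suc j) x = trans (e _) (iter-invariant h e j x)

module ToGraph {n : ℕ} {C : Code n} (G : PlaneMap C) where
  open PlaneMap G

  toVertex : Fin l × Bool → Fin l ⊎ Fin l
  toVertex (i , true)  = inj₁ i
  toVertex (i , false) = inj₂ i

  fromVertex : Fin l ⊎ Fin l → Fin l × Bool
  fromVertex (inj₁ i) = i , true
  fromVertex (inj₂ i) = i , false

  from-toVertex : ∀ i → fromVertex (toVertex i) ≡ i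
  from-toVertex (i , true)  = refl
  from-toVertex (i , false) = refl

  to-fromVertex : ∀ v → toVertex (fromVertex v) ≡ v
  to-fromVertex (inj₁ i) = refl
  to-fromVertex (inj₂ i) = refl

  vertex : V → Fin l ⊎ Fin l
  vertex v = toVertex (encV v)

  unvertex : Fin l ⊎ Fin l → V
  unvertex v = decV (fromVertex v)

  unvertex-vertex : ∀ v → unvertex (vertex v) ≡ v
  unvertex-vertex v = trans (cong decV (from-toVertex (encV v))) (decV-encV v)

  vertex-unvertex : ∀ v → vertex (unvertex v) ≡ v
  vertex-unvertex v = trans (cong toVertex (encV-decV (fromVertex v))) (to-fromVertex v)

  vertex-injective : ∀ {v w} → vertex v ≡ vertex w → v ≡ w
  vertex-injective {v} {w} e = trans (sym (unvertex-vertex v)) (trans (cong unvertex e) (unvertex-vertex w))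

  decD-α : ∀ d → decD (Defs.α d) ≡ rev (decD d)
  decD-α d = encD-injective (trans (encD-decD _) (sym (trans (encD-rev _)
    (cong (λ i → proj₁ i , not (proj₂ i)) (encD-decD d)))))

  decD-injective : ∀ {d d′} → decD d ≡ decD d′ → d ≡ d′
  decD-injective {d} {d′} e = trans (sym (encD-decD d)) (trans (cong encD e) (encD-decD d′))

  white black : Fin m → Fin l
  white e = proj₁ (encV (tail (decD (e , true))))
  black e = proj₁ (encV (tail (decD (e , false))))

  colour-decD : ∀ d → colour (decD d) ≡ proj₂ d
  colour-decD d = cong proj₂ (encD-decD d)

  dartTail≡ : ∀ d → dartTail white black d ≡ vertex (tail (decD d))
  dartTail≡ (e , true)  = cong (λ b → toVertex (white e , b)) (sym (trans (tail-colour _) (colour-decD (e , true))))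
  dartTail≡ (e , false) = cong (λ b → toVertex (black e , b)) (sym (trans (tail-colour _) (colour-decD (e , false))))

  dartTail⇒tail : ∀ {d d′} → dartTail white black d ≡ dartTail white black d′ → tail (decD d) ≡ tail (decD d′)
  dartTail⇒tail {d} {d′} e = vertex-injective (trans (sym (dartTail≡ d)) (trans e (dartTail≡ d′)))

  ends-injective : ∀ {d d′} → tail d ≡ tail d′ → tail (rev d) ≡ tail (rev d′) → d ≡ d′
  ends-injective {d} {d′} e e′ = just-injective
    (trans (sym (find-ends d)) (trans (cong₂ find e e′) (find-ends d′)))

  simple : ∀ e e′ → white e ≡ white e′ → black e ≡ black e′ → e ≡ e′
  simple e e′ ew eb = cong proj₁ (decD-injective (ends-injective
    (dartTail⇒tail {e , true} {e′ , true} (cong inj₁ ew))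
    (subst₂ (λ d d′ → tail d ≡ tail d′) (decD-α (e , true)) (decD-α (e′ , true))
      (dartTail⇒tail {e , false} {e′ , false} (cong inj₂ eb)))))

  Adj : Fin l ⊎ Fin l → Fin l ⊎ Fin l → Set
  Adj a b = ∃[ d ] (dartTail white black d ≡ a × dartTail white black (Defs.α d) ≡ b)

  dartTail-encD : ∀ d → dartTail white black (encD d) ≡ vertex (tail d)
  dartTail-encD d = trans (dartTail≡ (encD d)) (cong (vertex ∘ tail) (decD-encD d))

  adjacent : ∀ {a b} → ∃[ d ] (tail d ≡ a × tail (rev d) ≡ b) → Adj (vertex a) (vertex b)
  adjacent (d , refl , refl) = encD d , dartTail-encD d ,
    trans (cong (dartTail white black) (sym (encD-rev d))) (dartTail-encD (rev d))

  adjacent-sym : ∀ {a b} → Adj a b → Adj b a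
  adjacent-sym ((e , b) , ea , eb) = (e , not b) , eb , trans (cong (λ b → dartTail white black (e , b)) (not-involutive b)) ea

  connected : ∀ u v → Star Adj u v
  connected u v = reverse adjacent-sym (fromOrigin u) ◅◅ fromOrigin v
    where
    fromOrigin : ∀ v → Star Adj (vertex origin) v
    fromOrigin v = subst (Star Adj (vertex origin)) (vertex-unvertex v) (gmap vertex adjacent (reach (unvertex v)))

  σᴳ σ⁻¹ᴳ φᴳ : Dart m → Dart m
  σᴳ d   = encD (σ (decD d))
  σ⁻¹ᴳ d = encD (rev (ψ (decD d)))
  φᴳ d   = σᴳ (Defs.α d)

  decD-φᴳ : ∀ d → decD (φᴳ d) ≡ φ (decD d)
  decD-φᴳ d = trans (decD-encD _) (cong φ (trans (cong rev (decD-α d)) (rev-rev _)))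

  iter-σᴳ : ∀ j d → iter σᴳ j (encD d) ≡ encD (iter σ j d)
  iter-σᴳ = iter-conj encD (λ d → cong (encD ∘ σ) (decD-encD d))

  iter-φᴳ : ∀ j d → iter φᴳ j (encD d) ≡ encD (iter φ j d)
  iter-φᴳ = iter-conj encD λ d → trans (sym (encD-decD _)) (cong encD (trans (decD-φᴳ (encD d)) (cong φ (decD-encD d))))

  faceᴳ : Dart m → Fin (suc n)
  faceᴳ = face ∘ decD

  fromOrbit : ∀ {f : D → D} {g : Dart m → Dart m} → (∀ j d → iter g j (encD d) ≡ encD (iter f j d)) →
              ∀ {d d′} → Star (Step f) (decD d) (decD d′) → ∃[ j ] iter g j d ≡ d′
  fromOrbit {f} {g} conj {d} {d′} p with orbit⇒iter p
  ... | j , e = j , trans (cong (iter g j) (sym (encD-decD d)))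
                      (trans (conj j (decD d)) (trans (cong encD e) (encD-decD d′)))

  graph : PlaneBipartiteGraph
  graph = record
    { nw = l ; nb = l ; m = m ; white = white ; black = black ; simple = simple
    ; connected = connected
    ; σ = σᴳ ; σ⁻¹ = σ⁻¹ᴳ
    ; σσ⁻¹ = λ d → trans (cong (encD ∘ σ) (decD-encD _))
        (trans (cong (encD ∘ φ) (rev-rev _)) (trans (cong encD (φψ _)) (encD-decD d)))
    ; σ⁻¹σ = λ d → trans (cong (encD ∘ rev ∘ ψ) (decD-encD _))
        (trans (cong (encD ∘ rev) (ψφ _)) (trans (cong encD (rev-rev _)) (encD-decD d)))
    ; σ-tail = λ d → trans (dartTail-encD _) (trans (cong vertex (trans (tail-φ _) (cong tail (rev-rev _)))) (sym (dartTail≡ d)))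
    ; σ-cyclic = λ d d′ e → fromOrbit iter-σᴳ (sameTail⇒orbit (dartTail⇒tail {d} {d′} e))
    ; F = suc n ; face = faceᴳ
    ; face-surj = λ f → encD (dartOn f) , trans (cong face (decD-encD _)) (face-dartOn f)
    ; face-orbit = λ d d′ → mk⇔ (λ e → fromOrbit iter-φᴳ (sameFace⇒orbit e))
        λ { (j , refl) → sym (iter-invariant faceᴳ (λ d → trans (cong face (decD-φᴳ d)) (face-φ _)) j d) }
    ; euler = euler
    ; outer = zero
    }

  -- Perfect matchings of the graph and closed sets

  module Gr = PlaneBipartiteGraph graph

  onDarts : Subset m → D → Bool
  onDarts M d = lookup M (proj₁ (encD d))

  onDarts-symmetric : ∀ M → Symmetric (onDarts M)
  onDarts-symmetric M d = cong (lookup M ∘ proj₁) (encD-rev d)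

  onDarts-decD : ∀ M d → onDarts M (decD d) ≡ lookup M (proj₁ d)
  onDarts-decD M d = cong (lookup M ∘ proj₁) (encD-decD d)

  onEdges : (D → Bool) → Subset m
  onEdges M = tabulate (λ e → M (decD (e , true)))

  onDarts-onEdges : ∀ M → Symmetric M → ∀ d → onDarts (onEdges M) d ≡ M d
  onDarts-onEdges M symm d = trans (lookup∘tabulate _ (proj₁ (encD d))) (go (encD d) (decD-encD d))
    where
    go : ∀ i → decD i ≡ d → M (decD (proj₁ i , true)) ≡ M d
    go (e , true)  eq = cong M eq
    go (e , false) eq = trans (cong M (decD-α (e , false))) (trans (symm _) (cong M eq))

  onEdges-onDarts : ∀ M → onEdges (onDarts M) ≡ M
  onEdges-onDarts M = trans (tabulate-cong (λ e → onDarts-decD M (e , true))) (tabulate∘lookup M)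

  incident⇒dart : ∀ {e v} → Gr.Incident e v → ∃[ b ] tail (decD (e , b)) ≡ unvertex v
  incident⇒dart {e} (inj₁ refl) = true , sym (trans (cong unvertex (dartTail≡ (e , true))) (unvertex-vertex _))
  incident⇒dart {e} (inj₂ refl) = false , sym (trans (cong unvertex (dartTail≡ (e , false))) (unvertex-vertex _))

  dart⇒incident : ∀ {d v} → tail d ≡ v → Gr.Incident (proj₁ (encD d)) (vertex v)
  dart⇒incident {d} refl with encD d | dartTail-encD d
  ... | e , true  | eq = inj₁ eq
  ... | e , false | eq = inj₂ eq

  -- The colour of the tail tells apart the two darts of an edge. This turns uniqueness of the
  -- matched edge at a vertex into uniqueness of the matched dart.
  sameEdge : ∀ {d d′} → tail d ≡ tail d′ → proj₁ (encD d) ≡ proj₁ (encD d′) → d ≡ d′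
  sameEdge {d} {d′} e e′ = encD-injective (cong₂ _,_ e′
    (trans (sym (tail-colour d)) (trans (cong (proj₂ ∘ encV) e) (tail-colour d′))))

  isPerfect⇒ : ∀ M → Gr.IsPerfectMatching M → Perfect tail (onDarts M)
  isPerfect⇒ M P v with P (vertex v)
  ... | (e , e∈M , inc) , uniq with incident⇒dart inc
  ... | b , eq = decD (e , b) , tv , trans (onDarts-decD M (e , b)) ([]=⇒lookup e∈M) , λ d′ d′v d′M →
      sameEdge (trans d′v (sym tv)) (trans (uniq _ e (lookup⇒[]= _ M d′M) (dart⇒incident d′v) e∈M inc)
                                      (sym (cong proj₁ (encD-decD (e , b)))))
    where
    tv : tail (decD (e , b)) ≡ v
    tv = trans eq (unvertex-vertex v)

  isPerfect⇐ : ∀ M → Perfect tail (onDarts M) → Gr.IsPerfectMatching M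
  isPerfect⇐ M P v with P (unvertex v)
  ... | d , dv , dM , uniq =
      (proj₁ (encD d) , lookup⇒[]= _ M dM , subst (Gr.Incident _) (vertex-unvertex v) (dart⇒incident dv)) ,
      λ e e′ e∈ ie e′∈ ie′ → trans (only e∈ ie) (sym (only e′∈ ie′))
    where
    only : ∀ {e} → e ∈ M → Gr.Incident e v → e ≡ proj₁ (encD d)
    only {e} e∈ ie with incident⇒dart ie
    ... | b , eq = trans (sym (cong proj₁ (encD-decD (e , b))))
      (cong (proj₁ ∘ encD) (uniq (decD (e , b)) eq (trans (onDarts-decD M (e , b)) ([]=⇒lookup e∈))))

  toMatching : (Fin n → Bool) → Subset m
  toMatching S = onEdges (matching S)

  toMatching-cong : ∀ {S S′} → (∀ x → S x ≡ S′ x) → toMatching S ≡ toMatching S′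
  toMatching-cong e = tabulate-cong (λ i → edgeValue-cong (colour (decD (i , true))) _ _ (λ x _ → e x))

  toMatching-value : ∀ S d → onDarts (toMatching S) d ≡ matching S d
  toMatching-value S = onDarts-onEdges (matching S) (matching-symmetric S)

  toDownSet : Subset m → Fin n → Bool
  toDownSet M = downSet (onDarts M)

  toMatching-perfect : ∀ {S} → Closed C S → Gr.IsPerfectMatching (toMatching S)
  toMatching-perfect {S} S↓ = isPerfect⇐ _ (perfect-resp (toMatching-value S) (matching-perfect S S↓))

  toDownSet-closed : ∀ {M} → Gr.IsPerfectMatching M → Closed C (toDownSet M)
  toDownSet-closed {M} P = downSet-closed (onDarts M) (onDarts-symmetric M) (isPerfect⇒ M P)

  toDownSet-toMatching : ∀ S x → toDownSet (toMatching S) x ≡ S x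
  toDownSet-toMatching S x = trans (toMatching-value S (side x false))
    (trans (matching-side S (side x false) (side-face x false) (side-outer x false)) (cong (_xor S x) (side-colour x false)))

  toMatching-toDownSet : ∀ {M} → Gr.IsPerfectMatching M → toMatching (toDownSet M) ≡ M
  toMatching-toDownSet {M} P = trans
    (tabulate-cong (λ e → sym (matching-downSet (onDarts M) (onDarts-symmetric M) (isPerfect⇒ M P) (decD (e , true)))))
    (onEdges-onDarts M)

  -- Inclusion of closed sets and directed paths of matchings

  colour-φ : ∀ d → colour (φ d) ≡ not (colour d)
  colour-φ d = trans (sym (tail-colour (φ d))) (trans (cong (proj₂ ∘ encV) (tail-φ d))
    (trans (tail-colour (rev d)) (colour-rev d)))

  colour-φᴳ : ∀ d → proj₂ (φᴳ d) ≡ not (proj₂ d)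
  colour-φᴳ d = trans (sym (colour-decD (φᴳ d))) (trans (cong colour (decD-φᴳ d)) (trans (colour-φ (decD d)) (cong not (colour-decD d))))

  edge-or-rev : ∀ {d d′} → proj₁ (encD d) ≡ proj₁ (encD d′) → d ≡ d′ ⊎ d ≡ rev d′
  edge-or-rev {d} {d′} e with same-or-not (colour d) (colour d′)
  ... | inj₁ e′ = inj₁ (encD-injective (cong₂ _,_ e e′))
  ... | inj₂ e′ = inj₂ (encD-injective (trans (cong₂ _,_ e e′) (sym (encD-rev d′))))

  edge-decD : ∀ {d : Dart m} {d′} → proj₁ d ≡ proj₁ (encD d′) → proj₁ (encD (decD d)) ≡ proj₁ (encD d′)
  edge-decD {d} e = trans (cong proj₁ (encD-decD d)) e

  -- No vertex repeats, since `at` recovers a dart from its inner face and tail; no edge repeats,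
  -- since a dart and its reverse lie on different faces.
  boundaryIsCycle : ∀ x → Gr.BoundaryIsCycle (suc x)
  boundaryIsCycle x =
    (λ d d′ fd fd′ e → decD-injective (just-injective (trans (sym (at-tail (decD d) fd))
      (trans (cong (at x) (dartTail⇒tail {d} {d′} e)) (at-tail (decD d′) fd′))))) ,
    (λ d d′ fd fd′ e → decD-injective ([ (λ eq → eq)
       , (λ eq → contradiction (trans (sym (cong face eq)) (trans fd (sym fd′))) (face-rev (decD d′))) ]′
       (edge-or-rev (edge-decD {d} (trans e (sym (cong proj₁ (encD-decD d′))))))))

  module _ {S S′ : Fin n → Bool} (S↓ : Closed C S) (S′↓ : Closed C S′) {f : Fin n}
           (f∉S : S f ≡ false) (f∈S′ : S′ f ≡ true) (agree : ∀ x → x ≢ f → S x ≡ S′ x) where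

    private
      arc⇒≢ : ∀ {u v} → CodeArc C u v → u ≢ v
      arc⇒≢ uv refl = <-irrefl refl (rank-decreases uv)

      above : ∀ {v} → CodeArc C v f → S′ v ≡ false
      above {v} vf with S′ v in e
      ... | false = refl
      ... | true  = trans (sym (S↓ vf (trans (agree v (arc⇒≢ vf)) e))) f∉S

      below : ∀ {v} → CodeArc C f v → S v ≡ true
      below {v} fv = trans (agree v (arc⇒≢ fv ∘ sym)) (S′↓ fv f∈S′)

    -- `f` is maximal in `S′` and minimal outside `S`. Across a dart of `f` that starts at a black
    -- vertex lies the outer face or a face above `f`, which is outside `S′`; across one that starts
    -- at a white vertex lies the outer face or a face below `f`, which is in `S`.
    on-face : ∀ d → face d ≡ suc f → matching S′ d ≡ not (colour d) × matching S d ≡ colour d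
    on-face d fd with colour d in cd
    ... | false rewrite fd | f∉S | f∈S′ = outside (face (rev d)) refl , refl
      where
      outside : ∀ g → face (rev d) ≡ g → not (insideW S′ g) ≡ true
      outside zero    _ = refl
      outside (suc v) e = cong not (above (face-arc d cd fd e))
    ... | true rewrite fd | f∉S | f∈S′ = ∧-zeroʳ _ , trans (∧-identityʳ _) (inside (face (rev d)) refl)
      where
      inside : ∀ g → face (rev d) ≡ g → insideB S g ≡ true
      inside zero    _ = refl
      inside (suc v) e = below (face-arc (rev d) (trans (colour-rev d) (cong not cd)) e (trans (cong face (rev-rev d)) fd))

    off-face : ∀ d → face d ≢ suc f → face (rev d) ≢ suc f → matching S′ d ≡ matching S d
    off-face d ≢f ≢f′ = edgeValue-cong (colour d) _ _ λ
      { x (inj₁ e) → sym (agree x (λ { refl → ≢f e })) ; x (inj₂ e) → sym (agree x (λ { refl → ≢f′ e })) }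

    private
      M′ = toMatching S′
      M  = toMatching S

      value-M′ : ∀ d → lookup M′ (proj₁ d) ≡ matching S′ (decD d)
      value-M′ d = trans (sym (onDarts-decD M′ d)) (toMatching-value S′ (decD d))

      value-M : ∀ d → lookup M (proj₁ d) ≡ matching S (decD d)
      value-M d = trans (sym (onDarts-decD M d)) (toMatching-value S (decD d))

      on-M′ : ∀ d → faceᴳ d ≡ suc f → lookup M′ (proj₁ d) ≡ not (proj₂ d)
      on-M′ d fd = trans (value-M′ d) (trans (proj₁ (on-face (decD d) fd)) (cong not (colour-decD d)))

      on-M : ∀ d → faceᴳ d ≡ suc f → lookup M (proj₁ d) ≡ proj₂ d
      on-M d fd = trans (value-M d) (trans (proj₂ (on-face (decD d) fd)) (colour-decD d))

      bounds⇒ : ∀ e → lookup M′ e xor lookup M e ≡ true → ∃[ d ] (faceᴳ d ≡ suc f × proj₁ d ≡ e)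
      bounds⇒ e ne with faceᴳ (e , true) ≟ᶠ suc f | faceᴳ (e , false) ≟ᶠ suc f
      ... | yes fd | _      = (e , true) , fd , refl
      ... | no _   | yes fd = (e , false) , fd , refl
      ... | no n₁  | no n₂  = contradiction (trans (sym ne) (trans (cong (_xor lookup M e) same) (xor-same (lookup M e)))) λ ()
        where
        same : lookup M′ e ≡ lookup M e
        same = trans (value-M′ (e , true)) (trans
          (off-face (decD (e , true)) n₁ (n₂ ∘ trans (cong face (decD-α (e , true))))) (sym (value-M (e , true))))

      bounds⇐ : ∀ e → ∃[ d ] (faceᴳ d ≡ suc f × proj₁ d ≡ e) → lookup M′ e xor lookup M e ≡ true
      bounds⇐ e (d , fd , refl) rewrite on-M′ d fd | on-M d fd = not-xor (proj₂ d)

    removal : Gr.ZArc (toMatching S′) (toMatching S)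
    removal = suc f , (λ ()) , boundaryIsCycle f , (λ e → mk⇔ (bounds⇒ e) (bounds⇐ e)) , alternating , proper
      where
      alternating : Gr.Alternating M′ (suc f)
      alternating d fd rewrite on-M′ d fd
        | on-M′ (φᴳ d) (trans (cong face (decD-φᴳ d)) (trans (face-φ (decD d)) fd)) | colour-φᴳ d | not-involutive (proj₂ d) = not-xor (proj₂ d)
      proper : Gr.Proper M′ (suc f)
      proper d fd d∈ = trans (sym (not-involutive _)) (cong not (trans (sym (on-M′ d fd)) ([]=⇒lookup d∈)))

  -- The elements of S′ ∖ S are removed in order of decreasing rank, which keeps the sets closed.
  module _ {S S′ : Fin n → Bool} (S↓ : Closed C S) (S′↓ : Closed C S′) (S⊆S′ : ∀ x → S x ≡ true → S′ x ≡ true) where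

    private
      U : ℕ → Fin n → Bool
      U t x = S x ∨ (S′ x ∧ (rank C x <ᵇ t))

      U⁻ : ∀ t x → U t x ≡ true → S x ≡ true ⊎ (S′ x ≡ true × rank C x < t)
      U⁻ t x e with S x | S′ x | rank C x <ᵇ t in r
      ... | true  | _    | _    = inj₁ refl
      ... | false | true | true = inj₂ (refl , <ᵇ⇒< _ _ (Equivalence.from T-≡ r))

      U⁺ : ∀ t x → S x ≡ true ⊎ (S′ x ≡ true × rank C x < t) → U t x ≡ true
      U⁺ t x (inj₁ e) rewrite e = refl
      U⁺ t x (inj₂ (e , r)) rewrite e | Equivalence.to T-≡ (<⇒<ᵇ r) = ∨-zeroʳ (S x)

      U↓ : ∀ t → Closed C (U t)
      U↓ t {u} {v} uv Uu with U⁻ t u Uu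
      ... | inj₁ e       = U⁺ t v (inj₁ (S↓ uv e))
      ... | inj₂ (e , r) = U⁺ t v (inj₂ (S′↓ uv e , <-trans (rank-decreases uv) r))

      U-grows : ∀ t x → U t x ≡ true → U (suc t) x ≡ true
      U-grows t x e with U⁻ t x e
      ... | inj₁ e       = U⁺ (suc t) x (inj₁ e)
      ... | inj₂ (e , r) = U⁺ (suc t) x (inj₂ (e , m<n⇒m<1+n r))

      U-agree : ∀ t x → ¬ (rank C x ≡ t × S x ≡ false × S′ x ≡ true) → U t x ≡ U (suc t) x
      U-agree t x new = ⇔→≡ (mk⇔ (U-grows t x) back)
        where
        back : U (suc t) x ≡ true → U t x ≡ true
        back e with U⁻ (suc t) x e
        ... | inj₁ e′ = U⁺ t x (inj₁ e′)
        ... | inj₂ (e′ , r) with m<1+n⇒m<n∨m≡n r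
        ...   | inj₁ r′ = U⁺ t x (inj₂ (e′ , r′))
        ...   | inj₂ r′ with S x in es
        ...     | true  = refl
        ...     | false = contradiction (r′ , refl , e′) new

      -- Ranks are distinct, so at most one element leaves: the path is a single arc or empty.
      U-step : ∀ t → Star Gr.ZArc (toMatching (U (suc t))) (toMatching (U t))
      U-step t with any? (λ x → (rank C x ≟ⁿ t) ×-dec (S x ≟ᵇ false) ×-dec (S′ x ≟ᵇ true))
      ... | yes (x , refl , x∉S , x∈S′) = removal (U↓ t) (U↓ (suc t)) {x} x∉U (U⁺ (suc t) x (inj₂ (x∈S′ , n<1+n _)))
              (λ y y≢x → U-agree t y (λ { (r , _) → y≢x (rank-injective C y x r) })) ◅ ε
        where
        x∉U : U t x ≡ false
        x∉U with U t x in e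
        ... | false = refl
        ... | true with U⁻ t x e
        ...   | inj₁ x∈S    = trans (sym x∈S) x∉S
        ...   | inj₂ (_ , r) = contradiction r (<-irrefl refl)
      ... | no none = subst (Star Gr.ZArc _) (sym (toMatching-cong (λ x → U-agree t x (λ new → none (x , new))))) ε

      U-path : ∀ t → Star Gr.ZArc (toMatching (U t)) (toMatching S)
      U-path zero    = subst (λ M → Star Gr.ZArc M (toMatching S)) (toMatching-cong (λ x → ⇔→≡ (mk⇔ (U⁺ 0 x ∘ inj₁) (none x)))) ε
        where
        none : ∀ x → U 0 x ≡ true → S x ≡ true
        none x e with U⁻ 0 x e
        ... | inj₁ e′ = e′
        ... | inj₂ (_ , ())
      U-path (suc t) = U-step t ◅◅ U-path t

    toMatching-mono : toMatching S Gr.⪯ toMatching S′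
    toMatching-mono = subst (λ M → Star Gr.ZArc M (toMatching S))
      (toMatching-cong (λ x → ⇔→≡ (mk⇔ ([ S⊆S′ x , proj₁ ]′ ∘ U⁻ n x) (λ e → U⁺ n x (inj₂ (e , rank< C x)))))) (U-path n)

  -- If `x` were gained, its black outer side `s` would be outside `M₁` and on the boundary of the
  -- rotated face. By alternation the next dart on that face is in `M₁`, and it starts at a white
  -- vertex, which properness forbids.
  zArc⇒⊆ : ∀ {M₁ M₂} → Gr.ZArc M₁ M₂ → ∀ x → toDownSet M₂ x ≡ true → toDownSet M₁ x ≡ true
  zArc⇒⊆ {M₁} {M₂} (g , g≢outer , _ , bounds , alternating , proper) x e₂ with toDownSet M₁ x in e₁
  ... | true  = refl
  ... | false = contradiction (trans (sym colour-φs) (proper (φᴳ s) (trans (cong face (decD-φᴳ s)) (trans (face-φ _) s-on)) φs∈)) λ ()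
    where
    s : Dart m
    s = encD (side x false)
    on : ∃[ d ] (faceᴳ d ≡ g × proj₁ d ≡ proj₁ s)
    on = Equivalence.to (bounds (proj₁ s)) (cong₂ _xor_ e₁ e₂)
    s-on : faceᴳ s ≡ g
    s-on with on
    ... | d , dg , e with edge-or-rev (edge-decD {d} e)
    ...   | inj₁ eq = trans (cong face (trans (decD-encD _) (sym eq))) dg
    -- The reverse of `s` lies on the outer face, which is never the rotated one.
    ...   | inj₂ eq = contradiction (trans (sym dg) (trans (cong face eq) (side-outer x false))) g≢outer
    colour-φs : proj₂ (φᴳ s) ≡ true
    colour-φs = trans (colour-φᴳ s) (cong not (side-colour x false))
    φs∈ : proj₁ (φᴳ s) ∈ M₁
    φs∈ = lookup⇒[]= _ M₁ (trans (cong (_xor lookup M₁ (proj₁ (φᴳ s))) (sym e₁)) (alternating s s-on))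

  ⪯⇒⊆ : ∀ {M₁ M₂} → M₁ Gr.⪯ M₂ → ∀ x → toDownSet M₁ x ≡ true → toDownSet M₂ x ≡ true
  ⪯⇒⊆ ε       x e = e
  ⪯⇒⊆ (_◅_ {i = M₂} {j = M} a p) x e = zArc⇒⊆ {M₂} {M} a x (⪯⇒⊆ p x e)

-- Transport from the code to the given tree

module _ {n : ℕ} (T : OrientedTree n) where
  open Presentation (presentation T)
  open ToGraph (planeMap code)

  private
    pull : Subset n → Fin order → Bool
    pull S = lookup S ∘ label

    push : (Fin order → Bool) → Subset n
    push S = tabulate (S ∘ unlabel)

    pull-closed : ∀ {S} → IsDownSet T S → Closed code (pull S)
    pull-closed {S} S↓ uv e = []=⇒lookup (downSet⇒arcClosed T S↓ _ _ (label-arc uv) (lookup⇒[]= _ S e))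

    push-downSet : ∀ {S} → Closed code S → IsDownSet T (push S)
    push-downSet {S} S↓ = arcClosed⇒downSet T λ a b ab a∈ → lookup⇒[]= b _
      (trans (lookup∘tabulate _ b) (S↓ (unlabel-arc ab) (trans (sym (lookup∘tabulate _ a)) ([]=⇒lookup a∈))))

    push-pull : ∀ S → push (pull S) ≡ S
    push-pull S = trans (tabulate-cong (λ v → cong (lookup S) (label-unlabel v))) (tabulate∘lookup S)

    pull-push : ∀ S x → pull (push S) x ≡ S x
    pull-push S x = trans (lookup∘tabulate _ (label x)) (cong S (unlabel-label x))

    pull-⊆ : ∀ {S S′} → S ⊆ S′ → ∀ x → pull S x ≡ true → pull S′ x ≡ true
    pull-⊆ {S} {S′} S⊆S′ x e = []=⇒lookup (S⊆S′ (lookup⇒[]= _ S e))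

    ⊆-pull : ∀ {S S′} → (∀ x → pull S x ≡ true → pull S′ x ≡ true) → S ⊆ S′
    ⊆-pull {S} {S′} le {v} v∈ = lookup⇒[]= v S′ (trans (cong (lookup S′) (sym (label-unlabel v)))
      (le (unlabel v) (trans (cong (lookup S) (label-unlabel v)) ([]=⇒lookup v∈))))

  matchable : IsMDL (IsDownSet T) _⊆_
  matchable = graph , record
    { to      = toMatching ∘ pull
    ; from    = push ∘ toDownSet
    ; to-in   = λ S S↓ → toMatching-perfect (pull-closed S↓)
    ; from-in = λ M P → push-downSet (toDownSet-closed P)
    ; from-to = λ S _ → trans (tabulate-cong (λ v → toDownSet-toMatching (pull S) (unlabel v))) (push-pull S)
    ; to-from = λ M P → trans (toMatching-cong (pull-push (toDownSet M))) (toMatching-toDownSet P)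
    ; order   = λ S S′ S↓ S′↓ → mk⇔
        (λ (S⊆S′ : S ⊆ S′) → toMatching-mono (pull-closed S↓) (pull-closed S′↓) (pull-⊆ S⊆S′))
        (λ le → ⊆-pull λ x e → trans (sym (toDownSet-toMatching (pull S′) x))
          (⪯⇒⊆ le x (trans (toDownSet-toMatching (pull S) x) e)))
    }

theorem5p5 : ∀ (n : ℕ) (T : OrientedTree n) →
    Irreducible (IsDownSet T) _⊆_ × IsMDL (IsDownSet T) _⊆_
theorem5p5 n T = irreducible T , matchable T
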